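{- $[\mathbf{Txt}\mathbf{Psd}\mathbf{Bc}_C]_{\mathbf{REC}} = [\mathbf{Txt}\mathbf{G}\mathbf{Bc}_C]_{\mathbf{REC}}$.
   Context: Fix an acceptable numbering $(\varphi_e)_{e\in\mathbb{N}}$ of all partial computable functions. A number $e$ is a $C$-index if $\varphi_e$ is total with values in $\{0,1\}$; then $C_e=\{x:\varphi_e(x)=1\}$. $\mathbf{REC}$ is the collection of recursive subsets of $\mathbb{N}$; $\mathcal{P}$ denotes the partial computable functions. Fix a pause symbol $\#$. A text is a total function $T:\mathbb{N}\to\mathbb{N}\cup\{\#\}$, $\mathrm{content}(T)=\mathrm{range}(T)\setminus\{\#\}$, $T$ is a text for $L$ if $\mathrm{content}(T)=L$, $T[n]=(T(0),\dots,T(n-1))$. A learner is some $h\in\mathcal{P}$ (finite sequences/sets coded as numbers). Hypothesis sequences: $\mathbf{G}(h,T)(i)=h(T[i])$; partially set-driven $\mathbf{Psd}(h,T)(i)=h(\mathrm{content}(T[i]),i)$. Restriction $\mathbf{Bc}_C$ on hypothesis sequence $p$ and text $T$: there is $n_0$ such that for all $n\ge n_0$, $p(n)$ is a $C$-index with $C_{p(n)}=\mathrm{content}(T)$. A learner $h$ $\mathbf{Txt}\beta\mathbf{Bc}_C$-learns $L$ iff $\mathbf{Bc}_C(\beta(h,T),T)$ holds for every text $T$ for $L$; $[\mathbf{Txt}\beta\mathbf{Bc}_C]_{\mathbf{REC}}$ is the set of all classes $\mathcal{L}\subseteq\mathbf{REC}$ for which some $h\in\mathcal{P}$ learns every $L\in\mathcal{L}$.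 -}

module Defs where

open import Data.Nat using (ℕ; zero; suc; _+_; _*_; _^_; _≤_; _/_; _%_; ⌊_/2⌋; _≡ᵇ_)
open import Data.Bool using (Bool; true; false; if_then_else_)
open import Data.Maybe using (Maybe; just; nothing)
open import Data.Product using (_×_; _,_; proj₁; proj₂; Σ; ∃)
open import Data.Sum using (_⊎_)
open import Data.List using (List; []; _∷_; foldr; map; upTo)
open import Relation.Binary.PropositionalEquality using (_≡_)
open import Function.Bundles using (_⇔_)

tri : ℕ → ℕ
tri zero    = zero
tri (suc d) = tri d + suc d

pair : ℕ → ℕ → ℕ
pair x y = tri (x + y) + x

nextPair : ℕ × ℕ → ℕ × ℕ
nextPair (x , suc y) = (suc x , y)
nextPair (x , zero)  = (zero , suc x)

unpair : ℕ → ℕ × ℕ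
unpair zero    = (zero , zero)
unpair (suc n) = nextPair (unpair n)

-- Partial recursive functions (unary, on ℕ, via pairing), as codes
-- (same basis as Mathlib's Nat.Partrec.Code)

data Code : Set where
  zero′ succ′ left′ right′ : Code
  pair′ comp′ prec′        : Code → Code → Code
  rfind′                   : Code → Code

data Eval : Code → ℕ → ℕ → Set where
  ev-zero  : ∀ {n} → Eval zero′ n 0
  ev-succ  : ∀ {n} → Eval succ′ n (suc n)
  ev-left  : ∀ {n} → Eval left′ n (proj₁ (unpair n))
  ev-right : ∀ {n} → Eval right′ n (proj₂ (unpair n))
  ev-pair  : ∀ {f g n a b} → Eval f n a → Eval g n b → Eval (pair′ f g) n (pair a b)
  ev-comp  : ∀ {f g n m k} → Eval g n m → Eval f m k → Eval (comp′ f g) n k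
  ev-prec0 : ∀ {f g n a k} → unpair n ≡ (a , zero) → Eval f a k → Eval (prec′ f g) n k
  ev-precS : ∀ {f g n a y i k} → unpair n ≡ (a , suc y) →
             Eval (prec′ f g) (pair a y) i → Eval g (pair a (pair y i)) k →
             Eval (prec′ f g) n k
  -- rfind′ f on ⟨a , m⟩ : least k ≥ m with f⟨a,k⟩ = 0, all f⟨a,j⟩ (m ≤ j < k) defined
  ev-find0 : ∀ {f n a m} → unpair n ≡ (a , m) → Eval f (pair a m) 0 → Eval (rfind′ f) n m
  ev-findS : ∀ {f n a m z k} → unpair n ≡ (a , m) → Eval f (pair a m) (suc z) →
             Eval (rfind′ f) (pair a (suc m)) k → Eval (rfind′ f) n k

-- Gödel numbering of codes (decoding; fuel is always sufficient since
-- sub-codes have smaller numbers)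
decodeF : ℕ → ℕ → Code
decodeF zero _ = zero′
decodeF (suc f) zero = zero′
decodeF (suc f) (suc zero) = succ′
decodeF (suc f) (suc (suc zero)) = left′
decodeF (suc f) (suc (suc (suc zero))) = right′
decodeF (suc f) (suc (suc (suc (suc n)))) with n % 4
... | 0 = pair′ (decodeF f (proj₁ (unpair (n / 4)))) (decodeF f (proj₂ (unpair (n / 4))))
... | 1 = comp′ (decodeF f (proj₁ (unpair (n / 4)))) (decodeF f (proj₂ (unpair (n / 4))))
... | 2 = prec′ (decodeF f (proj₁ (unpair (n / 4)))) (decodeF f (proj₂ (unpair (n / 4))))
... | _ = rfind′ (decodeF f (n / 4))

decode : ℕ → Code
decode e = decodeF (suc e) e

φ : ℕ → ℕ → ℕ → Set
φ e x k = Eval (decode e) x k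

IsCIndex : ℕ → Set
IsCIndex e = ∀ x → ∃ λ k → φ e x k × (k ≡ 0 ⊎ k ≡ 1)

C : ℕ → ℕ → Set
C e x = φ e x 1

SetN : Set₁
SetN = ℕ → Set

_≐_ : SetN → SetN → Set
A ≐ B = ∀ x → A x ⇔ B x

Recursive : SetN → Set
Recursive L = ∃ λ e → IsCIndex e × (C e ≐ L)

-- Texts  (nothing = the pause symbol #)

Text : Set
Text = ℕ → Maybe ℕ

content : Text → SetN
content T x = ∃ λ n → T n ≡ just x

TextFor : Text → SetN → Set
TextFor T L = content T ≐ L

initSeg : Text → ℕ → List (Maybe ℕ)
initSeg T n = map T (upTo n)

codeSym : Maybe ℕ → ℕ
codeSym nothing  = 0
codeSym (just x) = suc x

codeSeq : List (Maybe ℕ) → ℕ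
codeSeq = foldr (λ a r → suc (pair (codeSym a) r)) 0

-- coding of finite sets as canonical indices:  D ↦ Σ_{x ∈ D} 2^x
testBit : ℕ → ℕ → Bool
testBit c zero    = (c % 2) ≡ᵇ 1
testBit c (suc x) = testBit ⌊ c /2⌋ x

insertBit : ℕ → ℕ → ℕ
insertBit x c = if testBit c x then c else c + 2 ^ x

insertSym : Maybe ℕ → ℕ → ℕ
insertSym nothing  c = c
insertSym (just x) c = insertBit x c

codeContent : List (Maybe ℕ) → ℕ
codeContent = foldr insertSym 0

-- Hypothesis sequences (partial: Hyp i e means the i-th hypothesis is e)

Hyp : Set₁
Hyp = ℕ → ℕ → Set

G : ℕ → Text → Hyp
G h T i e = φ h (codeSeq (initSeg T i)) e

Psd : ℕ → Text → Hyp
Psd h T i e = φ h (pair (codeContent (initSeg T i)) i) e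

BcC : Hyp → Text → Set
BcC p T = ∃ λ n₀ → ∀ n → n₀ ≤ n →
          ∃ λ e → p n e × IsCIndex e × (C e ≐ content T)

Learns : (ℕ → Text → Hyp) → ℕ → SetN → Set
Learns β h L = ∀ T → TextFor T L → BcC (β h T) T

InClassREC : (ℕ → Text → Hyp) → (SetN → Set) → Set₁
InClassREC β 𝓛 = (∀ L → 𝓛 L → Recursive L) × ∃ λ h → ∀ L → 𝓛 L → Learns β h L

-- A Psd-learner is a G-learner because (content(σ), |σ|) is computable from σ.
--
-- Conversely let h be a G-learner.  From (D, n) we produce a sequence over D and output h of it.  A candidate
-- k stands for the sequence σ coded by π₁ k, continued by the canonical (increasing) listing of D.  It is
-- disputed at (D, n) if, within n steps, h of an extension of σ · D↾k denies some element of D.  For the least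
-- undisputed candidate we take the prefix σ · D↾c with the largest c ≤ n that is confirmed: h of it denies,
-- within n steps, all y < c outside D.
--
-- Let D₀ ⊆ D₁ ⊆ … be the contents of the prefixes of a text for L.  A confirmed prefix with c above an element
-- of L ∖ Dₙ denies an element of L.  The text which follows σ · L and moves into the first such prefix shows
-- that either none occurs late, so that D↾c = L↾c and the hypothesis is right, or k becomes disputed.  Hence
-- each candidate is, from some moment on, right or disputed.  It remains to bound the least undisputed
-- candidate by a function growing so slowly that all candidates below it have reached that moment.  For
-- this, build a text which follows a candidate for its current prefix and moves into a disputing
-- extension whenever that candidate, although below the slow bound, is disputed.  The learner converges
-- on this text, so it moves only finitely often, and from then on some small candidate stays undisputed.
-- Everything is decidable at each moment, so no locking sequence has to be found.
module Submission where

open import Defs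
open import Data.Nat
open import Data.Nat.Properties
open import Data.Nat.DivMod
open import Data.Bool using (Bool; true; false; not; if_then_else_; _∧_; _∨_; T)
open import Data.Bool.Properties using (∨-zeroʳ)
open import Data.Empty using (⊥; ⊥-elim)
open import Data.Fin using (Fin; zero; suc; #_)
open import Data.List using (List; []; _∷_; _++_; map; length; [_]; _∷ʳ_; reverse; foldl; foldr; upTo; applyUpTo)
open import Data.List.Properties
  using (++-assoc; ++-identityʳ; length-++; foldl-++; reverse-foldl; map-upTo; length-map; length-upTo)
open import Data.List.Membership.Propositional using (_∈_)
open import Data.List.Membership.Propositional.Properties using (∈-map⁺; ∈-map⁻; ∈-upTo⁺; ∈-upTo⁻)
open import Data.List.Relation.Unary.All as All using (All; []; _∷_)
open import Data.List.Relation.Unary.All.Properties using (++⁺; ++⁻ʳ)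
open import Data.List.Relation.Unary.Any using (here; there)
open import Data.Maybe using (Maybe; just; nothing)
open import Data.Product using (_×_; _,_; proj₁; proj₂; ∃; ∃₂)
open import Data.Sum using (_⊎_; inj₁; inj₂)
open import Data.Vec using (Vec; []; _∷_; lookup; tabulate)
open import Data.Vec.Properties using (tabulate∘lookup)
open import Function using (_∘_)
open import Function.Bundles using (_⇔_; mk⇔; Equivalence)
open import Relation.Binary.PropositionalEquality hiding ([_])
open import Relation.Nullary using (yes; no)

open Equivalence using (to; from)

-- Cantor pairing.

-- Opaque copies of the pairing functions: unfolding these during evaluation of programs is very slow.
opaque
  pr : ℕ → ℕ → ℕ
  pr = pair

  π₁ π₂ : ℕ → ℕ
  π₁ n = proj₁ (unpair n)
  π₂ n = proj₂ (unpair n)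

  pr≡pair : ∀ x y → pr x y ≡ pair x y
  pr≡pair x y = refl

  unpair≡π : ∀ n → unpair n ≡ (π₁ n , π₂ n)
  unpair≡π n = refl

-- Induction along the enumeration: inside a diagonal `nextPair` raises x by one, and the entry (0 ,
-- suc d) comes right after (d , 0), the last one of the diagonal before.
unpair-pair : ∀ x y → unpair (pair x y) ≡ (x , y)
unpair-pair x y = go (x + y) x y refl
  where
  go : ∀ d x y → x + y ≡ d → unpair (tri d + x) ≡ (x , y)
  go zero    zero    zero    refl = refl
  go (suc d) zero    y       refl
    rewrite +-identityʳ (tri d + suc d) | +-suc (tri d) d | go d d 0 (+-identityʳ d) = refl
  go d       (suc x) y       eq
    rewrite +-suc (tri d) x | go d x (suc y) (trans (+-suc x y) eq) = refl

opaque
  unfolding pr π₁ π₂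

  pr-π : ∀ n → pr (π₁ n) (π₂ n) ≡ n
  pr-π zero    = refl
  pr-π (suc n) = trans (next (unpair n)) (cong suc (pr-π n))
    where
    next : ∀ p → pair (proj₁ (nextPair p)) (proj₂ (nextPair p)) ≡ suc (pair (proj₁ p) (proj₂ p))
    next (x , suc y) rewrite +-suc x y = +-suc _ x
    next (x , zero)
      rewrite +-identityʳ x | +-identityʳ (tri x + suc x) = +-suc (tri x) x

  π₁-pr : ∀ x y → π₁ (pr x y) ≡ x
  π₁-pr x y = cong proj₁ (unpair-pair x y)

  π₂-pr : ∀ x y → π₂ (pr x y) ≡ y
  π₂-pr x y = cong proj₂ (unpair-pair x y)

n≤tri : ∀ n → n ≤ tri n
n≤tri zero    = z≤n
n≤tri (suc n) = m≤n+m (suc n) (tri n)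

opaque
  unfolding pr

  x≤pr : ∀ x y → x ≤ pr x y
  x≤pr x y = m≤n+m x (tri (x + y))

  y≤pr : ∀ x y → y ≤ pr x y
  y≤pr x y = ≤-trans (m≤n+m y x) (≤-trans (n≤tri (x + y)) (m≤m+n _ x))

π₁≤ : ∀ n → π₁ n ≤ n
π₁≤ n = subst (π₁ n ≤_) (pr-π n) (x≤pr (π₁ n) (π₂ n))

π₂≤ : ∀ n → π₂ n ≤ n
π₂≤ n = subst (π₂ n ≤_) (pr-π n) (y≤pr (π₁ n) (π₂ n))

-- Gödel numbers of codes

opaque
  unfolding π₁ π₂

  decode-pair : ∀ f n → n % 4 ≡ 0 →
    decodeF (suc f) (4 + n) ≡ pair′ (decodeF f (π₁ (n / 4))) (decodeF f (π₂ (n / 4)))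
  decode-pair f n eq with n % 4 | eq
  ... | 0 | refl = refl

  decode-comp : ∀ f n → n % 4 ≡ 1 →
    decodeF (suc f) (4 + n) ≡ comp′ (decodeF f (π₁ (n / 4))) (decodeF f (π₂ (n / 4)))
  decode-comp f n eq with n % 4 | eq
  ... | 1 | refl = refl

  decode-prec : ∀ f n → n % 4 ≡ 2 →
    decodeF (suc f) (4 + n) ≡ prec′ (decodeF f (π₁ (n / 4))) (decodeF f (π₂ (n / 4)))
  decode-prec f n eq with n % 4 | eq
  ... | 2 | refl = refl

  decode-rfind : ∀ f n → n % 4 ≡ 3 →
    decodeF (suc f) (4 + n) ≡ rfind′ (decodeF f (n / 4))
  decode-rfind f n eq with n % 4 | eq
  ... | 3 | refl = refl

mod4 : ∀ r q → r < 4 → (r + q * 4) % 4 ≡ r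
mod4 r q r<4 = trans ([m+kn]%n≡m%n r q 4) (m<n⇒m%n≡m r<4)

div4 : ∀ r q → r < 4 → (r + q * 4) / 4 ≡ q
div4 r q r<4 = *-cancelʳ-≡ _ q 4 (+-cancelˡ-≡ r _ _ (trans
  (cong (_+ (r + q * 4) / 4 * 4) (sym (mod4 r q r<4)))
  (sym (m≡m%n+[m/n]*n (r + q * 4) 4))))

encode : Code → ℕ
encode zero′       = 0
encode succ′       = 1
encode left′       = 2
encode right′      = 3
encode (pair′ f g) = 4 + (0 + pr (encode f) (encode g) * 4)
encode (comp′ f g) = 4 + (1 + pr (encode f) (encode g) * 4)
encode (prec′ f g) = 4 + (2 + pr (encode f) (encode g) * 4)
encode (rfind′ f)  = 4 + (3 + encode f * 4)

private
  below : ∀ {f} r q → suc (4 + (r + q * 4)) ≤ suc f → q < f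
  below r q (s≤s le) = ≤-trans (s≤s (≤-trans (m≤m*n q 4) (m≤n+m (q * 4) r)))
    (≤-trans (m≤n+m (suc (r + q * 4)) 3) le)

  parts : ∀ r c d {f} → r < 4 → suc (4 + (r + pr (encode c) (encode d) * 4)) ≤ suc f →
          (encode c < f → decodeF f (encode c) ≡ c) → (encode d < f → decodeF f (encode d) ≡ d) →
          let q = (r + pr (encode c) (encode d) * 4) / 4 in
          decodeF f (π₁ q) ≡ c × decodeF f (π₂ q) ≡ d
  parts r c d {f} r<4 lt ih₁ ih₂ =
    trans (cong (decodeF f) (trans (cong π₁ q≡) (π₁-pr (encode c) (encode d))))
          (ih₁ (≤-<-trans (x≤pr (encode c) (encode d)) q<f)) ,
    trans (cong (decodeF f) (trans (cong π₂ q≡) (π₂-pr (encode c) (encode d))))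
          (ih₂ (≤-<-trans (y≤pr (encode c) (encode d)) q<f))
    where
    q≡ : (r + pr (encode c) (encode d) * 4) / 4 ≡ pr (encode c) (encode d)
    q≡ = div4 r (pr (encode c) (encode d)) r<4
    q<f : pr (encode c) (encode d) < f
    q<f = below r (pr (encode c) (encode d)) lt

  0<4 : 0 < 4
  0<4 = s≤s z≤n

  1<4 : 1 < 4
  1<4 = s≤s (s≤s z≤n)

  2<4 : 2 < 4
  2<4 = s≤s (s≤s (s≤s z≤n))

  3<4 : 3 < 4
  3<4 = s≤s (s≤s (s≤s (s≤s z≤n)))

decode-encode : ∀ c f → encode c < f → decodeF f (encode c) ≡ c
decode-encode zero′  (suc f) lt = refl
decode-encode succ′  (suc f) lt = refl
decode-encode left′  (suc f) lt = refl
decode-encode right′ (suc f) lt = refl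
decode-encode (pair′ c d) (suc f) lt
  with parts 0 c d 0<4 lt (decode-encode c f) (decode-encode d f)
... | c≡ , d≡ = trans (decode-pair f _ (mod4 0 (pr (encode c) (encode d)) 0<4)) (cong₂ pair′ c≡ d≡)
decode-encode (comp′ c d) (suc f) lt
  with parts 1 c d 1<4 lt (decode-encode c f) (decode-encode d f)
... | c≡ , d≡ = trans (decode-comp f _ (mod4 1 (pr (encode c) (encode d)) 1<4)) (cong₂ comp′ c≡ d≡)
decode-encode (prec′ c d) (suc f) lt
  with parts 2 c d 2<4 lt (decode-encode c f) (decode-encode d f)
... | c≡ , d≡ = trans (decode-prec f _ (mod4 2 (pr (encode c) (encode d)) 2<4)) (cong₂ prec′ c≡ d≡)
decode-encode (rfind′ c) (suc f) lt = trans (decode-rfind f _ (mod4 3 (encode c) 3<4))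
  (cong rfind′ (trans (cong (decodeF f) (div4 3 (encode c) 3<4)) (decode-encode c f (below 3 (encode c) lt))))

abstract
  -- Kept abstract: what matters is that some number simulates `c`, and `encode c` is far too large
  -- a number to be unfolded.
  gödel : (c : Code) → ∃ λ e → ∀ {x k} → Eval c x k → φ e x k
  gödel c = encode c , λ {x} {k} → subst (λ d → Eval d x k) (sym (decode-encode c (suc (encode c)) ≤-refl))

-- A small language of primitive recursive programs

data Exp : ℕ → Set where
  var       : ∀ {n} → Fin n → Exp n
  lit       : ∀ {n} → ℕ → Exp n
  `suc      : ∀ {n} → Exp n → Exp n
  `π₁ `π₂   : ∀ {n} → Exp n → Exp n
  `pair     : ∀ {n} → Exp n → Exp n → Exp n
  `rec      : ∀ {n} → Exp n → Exp n → Exp (2 + n) → Exp n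
  call      : ∀ {m n} → Exp m → Vec (Exp n) m → Exp n

natrec : ℕ → (ℕ → ℕ → ℕ) → ℕ → ℕ
natrec z s zero    = z
natrec z s (suc y) = s y (natrec z s y)

mutual
  ⟦_⟧ : ∀ {n} → Exp n → Vec ℕ n → ℕ
  ⟦ var i ⟧ ρ      = lookup ρ i
  ⟦ lit k ⟧ ρ      = k
  ⟦ `suc e ⟧ ρ     = suc (⟦ e ⟧ ρ)
  ⟦ `π₁ e ⟧ ρ      = π₁ (⟦ e ⟧ ρ)
  ⟦ `π₂ e ⟧ ρ      = π₂ (⟦ e ⟧ ρ)
  ⟦ `pair d e ⟧ ρ  = pr (⟦ d ⟧ ρ) (⟦ e ⟧ ρ)
  ⟦ `rec c b s ⟧ ρ = natrec (⟦ b ⟧ ρ) (λ y i → ⟦ s ⟧ (y ∷ i ∷ ρ)) (⟦ c ⟧ ρ)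
  ⟦ call f es ⟧ ρ  = ⟦ f ⟧ (⟦ es ⟧s ρ)

  ⟦_⟧s : ∀ {m n} → Vec (Exp n) m → Vec ℕ n → Vec ℕ m
  ⟦ [] ⟧s ρ     = []
  ⟦ e ∷ es ⟧s ρ = ⟦ e ⟧ ρ ∷ ⟦ es ⟧s ρ

-- Compilation of programs to codes.

⌜_⌝ : ∀ {n} → Vec ℕ n → ℕ
⌜ [] ⌝    = 0
⌜ v ∷ ρ ⌝ = pr v ⌜ ρ ⌝

id′ : Code
id′ = pair′ left′ right′

lit′ : ℕ → Code
lit′ zero    = zero′
lit′ (suc k) = comp′ succ′ (lit′ k)

var′ : ∀ {n} → Fin n → Code
var′ zero    = left′
var′ (suc i) = comp′ (var′ i) right′

mutual
  compile : ∀ {n} → Exp n → Code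
  compile (var i)      = var′ i
  compile (lit k)      = lit′ k
  compile (`suc e)     = comp′ succ′ (compile e)
  compile (`π₁ e)      = comp′ left′ (compile e)
  compile (`π₂ e)      = comp′ right′ (compile e)
  compile (`pair d e)  = pair′ (compile d) (compile e)
  compile (`rec c b s) =
    comp′ (prec′ (compile b)
                 -- `prec′` hands ⟨a , ⟨y , i⟩⟩ to its step, where a codes the environment; the code
                 -- of y ∷ i ∷ ρ is ⟨y , ⟨i , a⟩⟩.
                 (comp′ (compile s) (pair′ (comp′ left′ right′) (pair′ (comp′ right′ right′) left′))))
          (pair′ id′ (compile c))
  compile (call f es)  = comp′ (compile f) (compiles es)

  compiles : ∀ {m n} → Vec (Exp n) m → Code
  compiles []       = zero′
  compiles (e ∷ es) = pair′ (compile e) (compiles es)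

opaque
  unfolding pr π₁ π₂

  eval-π₁ : ∀ {n} → Eval left′ n (π₁ n)
  eval-π₁ = ev-left

  eval-π₂ : ∀ {n} → Eval right′ n (π₂ n)
  eval-π₂ = ev-right

  eval-pr : ∀ {f g n a b} → Eval f n a → Eval g n b → Eval (pair′ f g) n (pr a b)
  eval-pr = ev-pair

  eval-prec0 : ∀ {f g a k} → Eval f a k → Eval (prec′ f g) (pr a 0) k
  eval-prec0 {a = a} = ev-prec0 (unpair-pair a 0)

  eval-precS : ∀ {f g a y i k} → Eval (prec′ f g) (pr a y) i → Eval g (pr a (pr y i)) k →
               Eval (prec′ f g) (pr a (suc y)) k
  eval-precS {a = a} {y} = ev-precS (unpair-pair a (suc y))

eval-left : ∀ x y → Eval left′ (pr x y) x
eval-left x y = subst (Eval left′ (pr x y)) (π₁-pr x y) eval-π₁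

eval-right : ∀ x y → Eval right′ (pr x y) y
eval-right x y = subst (Eval right′ (pr x y)) (π₂-pr x y) eval-π₂

eval-id : ∀ x → Eval id′ x x
eval-id x = subst (Eval id′ x) (pr-π x) (eval-pr eval-π₁ eval-π₂)

eval-lit : ∀ k x → Eval (lit′ k) x k
eval-lit zero    x = ev-zero
eval-lit (suc k) x = ev-comp (eval-lit k x) ev-succ

eval-var : ∀ {n} (i : Fin n) ρ → Eval (var′ i) ⌜ ρ ⌝ (lookup ρ i)
eval-var zero    (v ∷ ρ) = eval-left v ⌜ ρ ⌝
eval-var (suc i) (v ∷ ρ) = ev-comp (eval-right v ⌜ ρ ⌝) (eval-var i ρ)

mutual
  compile-correct : ∀ {n} (e : Exp n) ρ → Eval (compile e) ⌜ ρ ⌝ (⟦ e ⟧ ρ)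
  compile-correct (var i)      ρ = eval-var i ρ
  compile-correct (lit k)      ρ = eval-lit k _
  compile-correct (`suc e)     ρ = ev-comp (compile-correct e ρ) ev-succ
  compile-correct (`π₁ e)      ρ = ev-comp (compile-correct e ρ) eval-π₁
  compile-correct (`π₂ e)      ρ = ev-comp (compile-correct e ρ) eval-π₂
  compile-correct (`pair d e)  ρ = eval-pr (compile-correct d ρ) (compile-correct e ρ)
  compile-correct (`rec c b s) ρ =
    ev-comp (eval-pr (eval-id _) (compile-correct c ρ)) (loop (⟦ c ⟧ ρ))
    where
    a = ⌜ ρ ⌝
    loop : ∀ y → Eval (prec′ (compile b) _) (pr a y) (natrec (⟦ b ⟧ ρ) (λ y i → ⟦ s ⟧ (y ∷ i ∷ ρ)) y)
    loop zero    = eval-prec0 (compile-correct b ρ)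
    loop (suc y) = eval-precS (loop y)
      (ev-comp
        (eval-pr (ev-comp (eval-right a _) (eval-left y _))
                 (eval-pr (ev-comp (eval-right a _) (eval-right y _)) (eval-left a _)))
        (compile-correct s (y ∷ _ ∷ ρ)))
  compile-correct (call f es)  ρ = ev-comp (compiles-correct es ρ) (compile-correct f _)

  compiles-correct : ∀ {m n} (es : Vec (Exp n) m) ρ → Eval (compiles es) ⌜ ρ ⌝ ⌜ ⟦ es ⟧s ρ ⌝
  compiles-correct []       ρ = ev-zero
  compiles-correct (e ∷ es) ρ = eval-pr (compile-correct e ρ) (compiles-correct es ρ)

v : ∀ {n} (i : ℕ) {i<n : _} → Exp n
v {n} i {i<n} = var (#_ i {n} {i<n})

-- A recursion whose step ignores counter and accumulator only tests whether its count is zero. The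
-- step finds b at position 4, behind counter, accumulator, c and a.
ifz : ∀ {n} → Exp n → Exp n → Exp n → Exp n
ifz c a b = call {3} (`rec (v 0) (v 1) (v 4)) (c ∷ a ∷ b ∷ [])

`pred : ∀ {n} → Exp n → Exp n
`pred e = call {1} (`rec (v 0) (lit 0) (v 0)) (e ∷ [])

-- The last entry also serves every larger value of `t`; `evalE` relies on this to treat all codes
-- from 4 on alike.
switch : ∀ {n} → Exp n → List (Exp n) → Exp n
switch t []       = lit 0
switch t (e ∷ []) = e
switch t (e ∷ es@(_ ∷ _)) = ifz t e (switch (`pred t) es)

-- Two predecessors give 0 exactly for the remainders 0, 1 and 2, which do not carry.
carryE : Exp 2
carryE = ifz (`pred (`pred (v 0))) (`pair (`suc (v 0)) (v 1)) (`pair (lit 0) (`suc (v 1)))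

modDiv4 : Exp 1
modDiv4 = `rec (v 0) (`pair (lit 0) (lit 0)) (call carryE (`π₁ (v 1) ∷ `π₂ (v 1) ∷ []))

modDiv4-correct : ∀ n → ⟦ modDiv4 ⟧ (n ∷ []) ≡ pr (n % 4) (n / 4)
modDiv4-correct n with inv n
  where
  next : ∀ {s} r q → s ≡ pr r q → ⟦ carryE ⟧ (π₁ s ∷ π₂ s ∷ []) ≡ ⟦ carryE ⟧ (r ∷ q ∷ [])
  next r q refl = cong₂ (λ x y → ⟦ carryE ⟧ (x ∷ y ∷ [])) (π₁-pr r q) (π₂-pr r q)
  inv : ∀ n → ∃₂ λ r q → r < 4 × n ≡ r + q * 4 × ⟦ modDiv4 ⟧ (n ∷ []) ≡ pr r q
  inv zero = 0 , 0 , 0<4 , refl , refl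
  inv (suc n) with inv n
  ... | 0 , q , _ , eq , val = 1 , q , 1<4 , cong suc eq , next 0 q val
  ... | 1 , q , _ , eq , val = 2 , q , 2<4 , cong suc eq , next 1 q val
  ... | 2 , q , _ , eq , val = 3 , q , 3<4 , cong suc eq , next 2 q val
  ... | 3 , q , _ , eq , val = 0 , suc q , 0<4 , cong suc eq , next 3 q val
  ... | suc (suc (suc (suc r))) , q , s≤s (s≤s (s≤s (s≤s ()))) , _
... | r , q , r<4 , refl , val = trans val (cong₂ pr (sym (mod4 r q r<4)) (sym (div4 r q r<4)))

-- An abstract machine for the codes

-- A machine state. In mode 0 the value a is returned to the stack K; in mode 1 the code a is to be
-- evaluated at b. The stack is 0 when empty and a successor otherwise, so no frame is mistaken for
-- its end.
mk : ℕ → ℕ → ℕ → ℕ → ℕ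
mk m a b K = pr m (pr a (pr b K))

ret : ℕ → ℕ → ℕ
ret a K = mk 0 a 0 K

ev : ℕ → ℕ → ℕ → ℕ
ev e x K = mk 1 e x K

push : ℕ → ℕ → ℕ → ℕ
push t u K = suc (pr (pr t u) K)

`mk : ∀ {n} → Exp n → Exp n → Exp n → Exp n → Exp n
`mk m a b K = `pair m (`pair a (`pair b K))

`ret : ∀ {n} → Exp n → Exp n → Exp n
`ret a K = `mk (lit 0) a (lit 0) K

`ev : ∀ {n} → Exp n → Exp n → Exp n → Exp n
`ev e x K = `mk (lit 1) e x K

`push : ∀ {n} → Exp n → Exp n → Exp n → Exp n
`push t u K = `suc (`pair (`pair t u) K)

-- A frame (tag, data) receives the value a: the two halves of pair′, the second half of comp′,
-- the step of prec′ and the test of rfind′.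
frameE : Exp 4
frameE = switch t
  ( `ev (`π₁ u) (`π₂ u) (`push (lit 1) a K)
  ∷ `ret (`pair u a) K
  ∷ `ev u a K
  ∷ `ev (`π₁ u) (`pair (`π₁ (`π₂ u)) (`pair (`π₂ (`π₂ u)) a)) K
  ∷ ifz a (`ret (`π₂ (`π₂ u)) K) (`ev (`π₁ u) (`pair (`π₁ (`π₂ u)) (`suc (`π₂ (`π₂ u)))) K)
  ∷ [])
  where
  t u a K : Exp 4
  t = v 0
  u = v 1
  a = v 2
  K = v 3

-- The remainder r selects the constructor and q codes its operands. The whole code e is passed
-- along because `prec′` and `rfind′` call themselves again.
compoundE : Exp 5
compoundE = switch r
  ( `ev (`π₁ q) x (`push (lit 0) (`pair (`π₂ q) x) K)
  ∷ `ev (`π₂ q) x (`push (lit 2) (`π₁ q) K)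
  ∷ ifz (`π₂ x) (`ev (`π₁ q) (`π₁ x) K)
        (`ev e (`pair (`π₁ x) (`pred (`π₂ x))) (`push (lit 3) (`pair (`π₂ q) (`pair (`π₁ x) (`pred (`π₂ x)))) K))
  ∷ `ev q x (`push (lit 4) (`pair e (`pair (`π₁ x) (`π₂ x))) K)
  ∷ [])
  where
  r q e x K : Exp 5
  r = v 0
  q = v 1
  e = v 2
  x = v 3
  K = v 4

evalE : Exp 3
evalE = switch e
  ( `ret (lit 0) K
  ∷ `ret (`suc x) K
  ∷ `ret (`π₁ x) K
  ∷ `ret (`π₂ x) K
  ∷ call compoundE (`π₁ dm ∷ `π₂ dm ∷ e ∷ x ∷ K ∷ [])
  ∷ [])
  where
  e x K dm : Exp 3
  e = v 0
  x = v 1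
  K = v 2
  dm = call modDiv4 (`pred (`pred (`pred (`pred e))) ∷ [])

-- A value returned to the empty stack is returned again. Halted runs therefore stay halted, which
-- makes every test with a step bound monotone in that bound.
step4E : Exp 4
step4E = ifz (v 0)
  (ifz (v 3) (`ret (v 1) (v 3))
    (call frameE (`π₁ (`π₁ (`pred (v 3))) ∷ `π₂ (`π₁ (`pred (v 3))) ∷ v 1 ∷ `π₂ (`pred (v 3)) ∷ [])))
  (call evalE (v 1 ∷ v 2 ∷ v 3 ∷ []))

opaque
  stepE : Exp 1
  stepE = call step4E (`π₁ (v 0) ∷ `π₁ (`π₂ (v 0)) ∷ `π₁ (`π₂ (`π₂ (v 0))) ∷ `π₂ (`π₂ (`π₂ (v 0))) ∷ [])

step : ℕ → ℕ
step S = ⟦ stepE ⟧ (S ∷ [])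

cong₄ : ∀ {A B C D E : Set} (f : A → B → C → D → E) {a a' b b' c c' d d'} →
        a ≡ a' → b ≡ b' → c ≡ c' → d ≡ d' → f a b c d ≡ f a' b' c' d'
cong₄ f refl refl refl refl = refl

opaque
  unfolding stepE

  step-mk : ∀ m a b K → step (mk m a b K) ≡ ⟦ step4E ⟧ (m ∷ a ∷ b ∷ K ∷ [])
  step-mk m a b K = cong₄ (λ m a b K → ⟦ step4E ⟧ (m ∷ a ∷ b ∷ K ∷ []))
    (π₁-pr m _)
    (trans (cong π₁ t) (π₁-pr a _))
    (trans (cong π₁ tt) (π₁-pr b K))
    (trans (cong π₂ tt) (π₂-pr b K))
    where
    t : π₂ (mk m a b K) ≡ pr a (pr b K)
    t = π₂-pr m _
    tt : π₂ (π₂ (mk m a b K)) ≡ pr b K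
    tt = trans (cong π₂ t) (π₂-pr a _)

step-frame : ∀ t u a K → step (ret a (push t u K)) ≡ ⟦ frameE ⟧ (t ∷ u ∷ a ∷ K ∷ [])
step-frame t u a K = trans (step-mk 0 a 0 (push t u K))
  (cong₄ (λ t u a K → ⟦ frameE ⟧ (t ∷ u ∷ a ∷ K ∷ []))
    (trans (cong π₁ f) (π₁-pr t u)) (trans (cong π₂ f) (π₂-pr t u)) refl (π₂-pr (pr t u) K))
  where
  f : π₁ (pr (pr t u) K) ≡ pr t u
  f = π₁-pr (pr t u) K

step-compound : ∀ r n x K → n % 4 ≡ r →
  step (ev (4 + n) x K) ≡ ⟦ compoundE ⟧ (r ∷ n / 4 ∷ 4 + n ∷ x ∷ K ∷ [])
step-compound r n x K eq = trans (step-mk 1 (4 + n) x K)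
  (cong₂ (λ r q → ⟦ compoundE ⟧ (r ∷ q ∷ 4 + n ∷ x ∷ K ∷ []))
    (trans (cong π₁ dm) (trans (π₁-pr _ _) eq))
    (trans (cong π₂ dm) (π₂-pr _ _)))
  where
  dm : ⟦ modDiv4 ⟧ (n ∷ []) ≡ pr (n % 4) (n / 4)
  dm = modDiv4-correct n

run : ℕ → ℕ → ℕ
run s S = natrec S (λ _ → step) s

_⟶_ : ℕ → ℕ → Set
S ⟶ S' = ∃ λ s → run s S ≡ S'

run-+ : ∀ s t S → run (s + t) S ≡ run s (run t S)
run-+ zero    t S = refl
run-+ (suc s) t S = cong step (run-+ s t S)

infixr 4 _⨟_
_⨟_ : ∀ {S S' S''} → S ⟶ S' → S' ⟶ S'' → S ⟶ S''
_⨟_ {S} (s , p) (t , q) = t + s , trans (run-+ t s S) (trans (cong (run t) p) q)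

one : ∀ {S S'} → step S ≡ S' → S ⟶ S'
one p = 1 , p

-- Derivations are indexed by codes, the machine runs on numbers. This recovers the shape of e from
-- the constructor that it decodes to, with enough fuel `f'` left for the operands.
Inv : Code → ℕ → ℕ → Set
Inv zero′       f e = e ≡ 0
Inv succ′       f e = e ≡ 1
Inv left′       f e = e ≡ 2
Inv right′      f e = e ≡ 3
Inv (pair′ c d) f e = ∃₂ λ f' n → e ≡ 4 + n × n % 4 ≡ 0 × n < f' ×
                      c ≡ decodeF f' (π₁ (n / 4)) × d ≡ decodeF f' (π₂ (n / 4))
Inv (comp′ c d) f e = ∃₂ λ f' n → e ≡ 4 + n × n % 4 ≡ 1 × n < f' ×
                      c ≡ decodeF f' (π₁ (n / 4)) × d ≡ decodeF f' (π₂ (n / 4))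
Inv (prec′ c d) f e = ∃₂ λ f' n → e ≡ 4 + n × n % 4 ≡ 2 × n < f' ×
                      c ≡ decodeF f' (π₁ (n / 4)) × d ≡ decodeF f' (π₂ (n / 4))
Inv (rfind′ c)  f e = ∃₂ λ f' n → e ≡ 4 + n × n % 4 ≡ 3 × n < f' × c ≡ decodeF f' (n / 4)

decode-inv : ∀ f e → e < f → Inv (decodeF f e) f e
decode-inv (suc f) 0 lt = refl
decode-inv (suc f) 1 lt = refl
decode-inv (suc f) 2 lt = refl
decode-inv (suc f) 3 lt = refl
decode-inv (suc f) (suc (suc (suc (suc n)))) (s≤s lt) = go (n % 4) refl (m%n<n n 4)
  where
  n<f : n < f
  n<f = ≤-trans (m≤n+m (suc n) 3) lt
  go : ∀ r → n % 4 ≡ r → r < 4 → Inv (decodeF (suc f) (4 + n)) (suc f) (4 + n)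
  go 0 eq _ = subst (λ c → Inv c (suc f) (4 + n)) (sym (decode-pair f n eq)) (f , n , refl , eq , n<f , refl , refl)
  go 1 eq _ = subst (λ c → Inv c (suc f) (4 + n)) (sym (decode-comp f n eq)) (f , n , refl , eq , n<f , refl , refl)
  go 2 eq _ = subst (λ c → Inv c (suc f) (4 + n)) (sym (decode-prec f n eq)) (f , n , refl , eq , n<f , refl , refl)
  go 3 eq _ = subst (λ c → Inv c (suc f) (4 + n)) (sym (decode-rfind f n eq)) (f , n , refl , eq , n<f , refl)
  go (suc (suc (suc (suc r)))) _ (s≤s (s≤s (s≤s (s≤s ()))))

prec-base : ∀ q e x K a → (π₁ x , π₂ x) ≡ (a , 0) →
  ⟦ compoundE ⟧ (2 ∷ q ∷ e ∷ x ∷ K ∷ []) ≡ ev (π₁ q) a K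
prec-base q e x K a eq with π₁ x | π₂ x | eq
... | _ | _ | refl = refl

prec-recur : ∀ q e x K a y → (π₁ x , π₂ x) ≡ (a , suc y) →
  ⟦ compoundE ⟧ (2 ∷ q ∷ e ∷ x ∷ K ∷ []) ≡ ev e (pair a y) (push 3 (pr (π₂ q) (pr a y)) K)
prec-recur q e x K a y eq with π₁ x | π₂ x | eq
... | _ | _ | refl = cong (λ z → ev e z (push 3 (pr (π₂ q) (pr a y)) K)) (pr≡pair a y)

prec-frame : ∀ g a y i K →
  ⟦ frameE ⟧ (3 ∷ pr g (pr a y) ∷ i ∷ K ∷ []) ≡ ev g (pair a (pair y i)) K
prec-frame g a y i K = cong₂ (λ e x → ev e x K) (π₁-pr g (pr a y))
  (trans (cong₂ (λ a y → pr a (pr y i)) (trans (cong π₁ t) (π₁-pr a y)) (trans (cong π₂ t) (π₂-pr a y)))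
         (trans (pr≡pair a (pr y i)) (cong (pair a) (pr≡pair y i))))
  where
  t : π₂ (pr g (pr a y)) ≡ pr a y
  t = π₂-pr g _

find-start : ∀ q e x K a m → (π₁ x , π₂ x) ≡ (a , m) →
  ⟦ compoundE ⟧ (3 ∷ q ∷ e ∷ x ∷ K ∷ []) ≡ ev q (pair a m) (push 4 (pr e (pr a m)) K)
find-start q e x K a m eq = cong₂ (λ z w → ev q z (push 4 (pr e w) K))
  (trans (sym (pr-π x)) (trans both (pr≡pair a m))) both
  where
  both : pr (π₁ x) (π₂ x) ≡ pr a m
  both = cong (λ p → pr (proj₁ p) (proj₂ p)) eq

find-data : ∀ e a m → let u = pr e (pr a m) in π₁ u ≡ e × π₁ (π₂ u) ≡ a × π₂ (π₂ u) ≡ m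
find-data e a m = π₁-pr e _ , trans (cong π₁ t) (π₁-pr a m) , trans (cong π₂ t) (π₂-pr a m)
  where
  t : π₂ (pr e (pr a m)) ≡ pr a m
  t = π₂-pr e _

find-frame : ∀ e a m z K →
  ⟦ frameE ⟧ (4 ∷ pr e (pr a m) ∷ suc z ∷ K ∷ []) ≡ ev e (pair a (suc m)) K
find-frame e a m z K with find-data e a m
... | p , q , r = cong₂ (λ e x → ev e x K) p
  (trans (cong₂ (λ a m → pr a (suc m)) q r) (pr≡pair a (suc m)))

private
  q< : ∀ {n f} → n < f → n / 4 < f
  q< {n} lt = ≤-<-trans (m/n≤m n 4) lt
  q₁< : ∀ {n f} → n < f → π₁ (n / 4) < f
  q₁< {n} lt = ≤-<-trans (≤-trans (π₁≤ (n / 4)) (m/n≤m n 4)) lt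
  q₂< : ∀ {n f} → n < f → π₂ (n / 4) < f
  q₂< {n} lt = ≤-<-trans (≤-trans (π₂≤ (n / 4)) (m/n≤m n 4)) lt

-- Induction on the derivation. The fuel is arbitrary because operands are decoded with less of it,
-- and the stack is arbitrary because they are evaluated under a pushed frame; the self-calls of
-- `prec′` and `rfind′` keep `f` and `e`.
machine-complete : ∀ {c x k} → Eval c x k → ∀ f e → e < f → c ≡ decodeF f e →
                   ∀ K → ev e x K ⟶ ret k K
machine-complete D f e lt ceq K with subst (λ c → Inv c f e) (sym ceq) (decode-inv f e lt)
machine-complete ev-zero f _ lt ceq K | refl = one (step-mk 1 0 _ K)
machine-complete ev-succ f _ lt ceq K | refl = one (step-mk 1 1 _ K)
machine-complete (ev-left {n = x}) f _ lt ceq K | refl =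
  one (trans (step-mk 1 2 x K) (cong (λ y → ret y K) (sym (cong proj₁ (unpair≡π x)))))
machine-complete (ev-right {n = x}) f _ lt ceq K | refl =
  one (trans (step-mk 1 3 x K) (cong (λ y → ret y K) (sym (cong proj₂ (unpair≡π x)))))
machine-complete (ev-pair {n = x} {a} {b} D₁ D₂) f _ lt ceq K
  | f' , n , refl , r , n<f , refl , refl =
    one (step-compound 0 n x K r)
  ⨟ machine-complete D₁ f' _ (q₁< n<f) refl _
  ⨟ one (trans (step-frame 0 _ a K)
          (cong₂ (λ e x → ev e x (push 1 a K)) (π₁-pr _ x) (π₂-pr (π₂ (n / 4)) x)))
  ⨟ machine-complete D₂ f' _ (q₂< n<f) refl _
  ⨟ one (trans (step-frame 1 a b K) (cong (λ y → ret y K) (pr≡pair a b)))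
machine-complete (ev-comp {n = x} {m} D₁ D₂) f _ lt ceq K
  | f' , n , refl , r , n<f , refl , refl =
    one (step-compound 1 n x K r)
  ⨟ machine-complete D₁ f' _ (q₂< n<f) refl _
  ⨟ one (step-frame 2 _ m K)
  ⨟ machine-complete D₂ f' _ (q₁< n<f) refl _
machine-complete (ev-prec0 {n = x} {a} eq D₁) f _ lt ceq K
  | f' , n , refl , r , n<f , refl , refl =
    one (trans (step-compound 2 n x K r) (prec-base (n / 4) (4 + n) x K a (trans (sym (unpair≡π x)) eq)))
  ⨟ machine-complete D₁ f' _ (q₁< n<f) refl _
machine-complete (ev-precS {n = x} {a} {y} {i} eq D₁ D₂) f _ lt ceq K
  | f' , n , refl , r , n<f , refl , refl =
    one (trans (step-compound 2 n x K r) (prec-recur (n / 4) (4 + n) x K a y (trans (sym (unpair≡π x)) eq)))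
  ⨟ machine-complete D₁ f (4 + n) lt ceq _
  ⨟ one (trans (step-frame 3 _ i K) (prec-frame (π₂ (n / 4)) a y i K))
  ⨟ machine-complete D₂ f' _ (q₂< n<f) refl _
machine-complete (ev-find0 {n = x} {a} {m} eq D₁) f _ lt ceq K
  | f' , n , refl , r , n<f , refl =
    one (trans (step-compound 3 n x K r) (find-start (n / 4) (4 + n) x K a m (trans (sym (unpair≡π x)) eq)))
  ⨟ machine-complete D₁ f' _ (q< n<f) refl _
  ⨟ one (trans (step-frame 4 _ 0 K) (cong (λ y → ret y K) (proj₂ (proj₂ (find-data (4 + n) a m)))))
machine-complete (ev-findS {n = x} {a} {m} {z} eq D₁ D₂) f _ lt ceq K
  | f' , n , refl , r , n<f , refl =
    one (trans (step-compound 3 n x K r) (find-start (n / 4) (4 + n) x K a m (trans (sym (unpair≡π x)) eq)))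
  ⨟ machine-complete D₁ f' _ (q< n<f) refl _
  ⨟ one (trans (step-frame 4 _ (suc z) K) (find-frame (4 + n) a m z K))
  ⨟ machine-complete D₂ f (4 + n) lt ceq K

val : ℕ → ℕ
val S = π₁ (π₂ S)

busyE : Exp 1
busyE = ifz (`π₁ (v 0)) (`π₂ (`π₂ (`π₂ (v 0)))) (lit 1)

Halted : ℕ → ℕ → Set
Halted S a = ⟦ busyE ⟧ (S ∷ []) ≡ 0 × val S ≡ a

ret-halted : ∀ a → Halted (ret a 0) a
ret-halted a = cong₂ (λ m K → ⟦ ifz (v 0) (v 1) (lit 1) ⟧ (m ∷ K ∷ [])) (π₁-pr 0 _) (trans (cong π₂ tt) (π₂-pr 0 0)) ,
  trans (cong π₁ t) (π₁-pr a _)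
  where
  t : π₂ (ret a 0) ≡ pr a (pr 0 0)
  t = π₂-pr 0 _
  tt : π₂ (π₂ (ret a 0)) ≡ pr 0 0
  tt = trans (cong π₂ t) (π₂-pr a _)

opaque
  unfolding stepE

  step-halted : ∀ {S a} → Halted S a → Halted (step S) a
  step-halted {S} {a} (idle , refl) = subst (λ S' → Halted S' a)
    (sym (stays (π₁ S) (π₁ (π₂ (π₂ S))) (π₂ (π₂ (π₂ S))) idle)) (ret-halted a)
    where
    stays : ∀ m b K → ⟦ ifz (v 0) (v 1) (lit 1) ⟧ (m ∷ K ∷ []) ≡ 0 →
            ⟦ step4E ⟧ (m ∷ val S ∷ b ∷ K ∷ []) ≡ ret (val S) 0
    stays zero    b zero    eq = refl
    stays zero    b (suc K) ()
    stays (suc m) b K       ()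

run-halted : ∀ s {S a} → Halted S a → Halted (run s S) a
run-halted zero    H = H
run-halted (suc s) H = step-halted (run-halted s H)

run-halted-≤ : ∀ {s t S a} → s ≤ t → Halted (run s S) a → Halted (run t S) a
run-halted-≤ {s} {t} {S} {a} s≤t H = subst (λ u → Halted u a)
  (trans (sym (run-+ (t ∸ s) s S)) (cong (λ u → run u S) (m∸n+n≡m s≤t))) (run-halted (t ∸ s) H)

run-halted-unique : ∀ {s t S a b} → Halted (run s S) a → Halted (run t S) b → a ≡ b
run-halted-unique {s} {t} H H' =
  trans (sym (proj₂ (run-halted-≤ (m≤m⊔n s t) H))) (proj₂ (run-halted-≤ (m≤n⊔m s t) H'))

φ-halted : ∀ {e x k} → φ e x k → ∃ λ s → Halted (run s (ev e x 0)) k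
φ-halted {e} {x} {k} D with machine-complete D (suc e) e ≤-refl refl 0
... | s , eq = s , subst (λ S → Halted S k) (sym eq) (ret-halted k)

-- Both derivations give halted runs from the same state, and the machine is deterministic.
φ-functional : ∀ {e x j k} → φ e x j → φ e x k → j ≡ k
φ-functional {e} {x} D D' with φ-halted {e} {x} D | φ-halted {e} {x} D'
... | s , H | t , H' = run-halted-unique {s} {t} H H'

-- Boolean programs

toN : Bool → ℕ
toN true  = 1
toN false = 0

isZero : ℕ → Bool
isZero zero    = true
isZero (suc _) = false

isZero-true : ∀ {n} → isZero n ≡ true → n ≡ 0
isZero-true {zero} _ = refl

∧-true : ∀ {a b} → a ∧ b ≡ true → a ≡ true × b ≡ true
∧-true {true} {true} _ = refl , refl

∨-true : ∀ {a b} → a ∨ b ≡ true → a ≡ true ⊎ b ≡ true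
∨-true {true}  _ = inj₁ refl
∨-true {false} e = inj₂ e

`if : ∀ {n} → Exp n → Exp n → Exp n → Exp n
`if c a b = ifz c b a

`and `or : ∀ {n} → Exp n → Exp n → Exp n
`and a b = `if a b (lit 0)
`or  a b = `if a (lit 1) b

`not `isZero : ∀ {n} → Exp n → Exp n
`not a = ifz a (lit 1) (lit 0)
`isZero a = ifz a (lit 1) (lit 0)

module _ {n} {ρ : Vec ℕ n} where

  `if-correct : ∀ c a b {p} → ⟦ c ⟧ ρ ≡ toN p →
                ⟦ `if c a b ⟧ ρ ≡ (if p then ⟦ a ⟧ ρ else ⟦ b ⟧ ρ)
  `if-correct c a b {p} eq rewrite eq with p
  ... | true  = refl
  ... | false = refl

  `and-correct : ∀ a b {p q} → ⟦ a ⟧ ρ ≡ toN p → ⟦ b ⟧ ρ ≡ toN q → ⟦ `and a b ⟧ ρ ≡ toN (p ∧ q)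
  `and-correct a b {p} eq eq' rewrite eq | eq' with p
  ... | true  = refl
  ... | false = refl

  `or-correct : ∀ a b {p q} → ⟦ a ⟧ ρ ≡ toN p → ⟦ b ⟧ ρ ≡ toN q → ⟦ `or a b ⟧ ρ ≡ toN (p ∨ q)
  `or-correct a b {p} eq eq' rewrite eq | eq' with p
  ... | true  = refl
  ... | false = refl

  `not-correct : ∀ a {p} → ⟦ a ⟧ ρ ≡ toN p → ⟦ `not a ⟧ ρ ≡ toN (not p)
  `not-correct a {p} eq rewrite eq with p
  ... | true  = refl
  ... | false = refl

  `isZero-correct : ∀ a {k} → ⟦ a ⟧ ρ ≡ k → ⟦ `isZero a ⟧ ρ ≡ toN (isZero k)
  `isZero-correct a {k} eq rewrite eq with k
  ... | zero  = refl
  ... | suc _ = refl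

natrec-cong : ∀ {z z' s s'} → z ≡ z' → (∀ y i → s y i ≡ s' y i) → ∀ n → natrec z s n ≡ natrec z' s' n
natrec-cong z≡ s≡ zero    = z≡
natrec-cong {s' = s'} z≡ s≡ (suc n) = trans (s≡ n _) (cong (s' n) (natrec-cong z≡ s≡ n))

-- The accumulator bound by an enclosing recursion is skipped.
under : ∀ {n} → Exp (suc n) → Exp (2 + n)
under b = call b (var zero ∷ tabulate (λ j → var (suc (suc j))))

⟦vars⟧ : ∀ {m n} (f : Fin m → Fin n) (ρ : Vec ℕ n) →
         ⟦ tabulate (var ∘ f) ⟧s ρ ≡ tabulate (lookup ρ ∘ f)
⟦vars⟧ {zero}  f ρ = refl
⟦vars⟧ {suc m} f ρ = cong (lookup ρ (f zero) ∷_) (⟦vars⟧ (f ∘ suc) ρ)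

⟦under⟧ : ∀ {n} (b : Exp (suc n)) y i ρ → ⟦ under b ⟧ (y ∷ i ∷ ρ) ≡ ⟦ b ⟧ (y ∷ ρ)
⟦under⟧ b y i ρ = cong (λ ρ' → ⟦ b ⟧ (y ∷ ρ'))
  (trans (⟦vars⟧ (λ j → suc (suc j)) (y ∷ i ∷ ρ)) (tabulate∘lookup ρ))

anyB allB : (ℕ → Bool) → ℕ → Bool
anyB f zero    = false
anyB f (suc n) = f n ∨ anyB f n
allB f zero    = true
allB f (suc n) = f n ∧ allB f n

-- One more than the first hit, or 0.
firstB : (ℕ → Bool) → ℕ → ℕ
firstB f zero    = 0
firstB f (suc n) with firstB f n
... | zero  = if f n then suc n else 0
... | suc k = suc k

-- The default is 0. In `nodeFor` it is a genuine hit, since c = 0 is confirmed vacuously.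
greatB : (ℕ → Bool) → ℕ → ℕ
greatB f zero    = 0
greatB f (suc n) = if f n then n else greatB f n

`any `all `first `great : ∀ {n} → Exp (suc n) → Exp n → Exp n
`any   b c = `rec c (lit 0) (`or (under b) (v 1))
`all   b c = `rec c (lit 1) (`and (under b) (v 1))
`first b c = `rec c (lit 0) (ifz (v 1) (`if (under b) (`suc (v 0)) (lit 0)) (v 1))
`great b c = `rec c (lit 0) (`if (under b) (v 0) (v 1))

module _ {n} (b : Exp (suc n)) {ρ : Vec ℕ n} {f : ℕ → Bool} (b≡f : ∀ y → ⟦ b ⟧ (y ∷ ρ) ≡ toN (f y)) where

  private
    body : ∀ y i → ⟦ under b ⟧ (y ∷ i ∷ ρ) ≡ toN (f y)
    body y i = trans (⟦under⟧ b y i ρ) (b≡f y)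

  `any-correct : ∀ c {m} → ⟦ c ⟧ ρ ≡ m → ⟦ `any b c ⟧ ρ ≡ toN (anyB f m)
  `any-correct c refl = go (⟦ c ⟧ ρ)
    where
    go : ∀ m → natrec 0 (λ y i → ⟦ `or (under b) (v 1) ⟧ (y ∷ i ∷ ρ)) m ≡ toN (anyB f m)
    go zero    = refl
    go (suc m) = `or-correct (under b) (v 1) (body m _) (go m)

  `all-correct : ∀ c {m} → ⟦ c ⟧ ρ ≡ m → ⟦ `all b c ⟧ ρ ≡ toN (allB f m)
  `all-correct c refl = go (⟦ c ⟧ ρ)
    where
    go : ∀ m → natrec 1 (λ y i → ⟦ `and (under b) (v 1) ⟧ (y ∷ i ∷ ρ)) m ≡ toN (allB f m)
    go zero    = refl
    go (suc m) = `and-correct (under b) (v 1) (body m _) (go m)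

  `great-correct : ∀ c {m} → ⟦ c ⟧ ρ ≡ m → ⟦ `great b c ⟧ ρ ≡ greatB f m
  `great-correct c refl = go (⟦ c ⟧ ρ)
    where
    go : ∀ m → natrec 0 (λ y i → ⟦ `if (under b) (v 0) (v 1) ⟧ (y ∷ i ∷ ρ)) m ≡ greatB f m
    go zero    = refl
    go (suc m) = trans (`if-correct (under b) (v 0) (v 1) (body m _)) (cong (if f m then m else_) (go m))

  `first-correct : ∀ c {m} → ⟦ c ⟧ ρ ≡ m → ⟦ `first b c ⟧ ρ ≡ firstB f m
  `first-correct c refl = go (⟦ c ⟧ ρ)
    where
    go : ∀ m → natrec 0 (λ y i → ⟦ ifz (v 1) (`if (under b) (`suc (v 0)) (lit 0)) (v 1) ⟧ (y ∷ i ∷ ρ)) m ≡ firstB f m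
    go zero = refl
    go (suc m) rewrite go m with firstB f m
    ... | zero  = `if-correct {ρ = m ∷ 0 ∷ ρ} (under b) (`suc (v 0)) (lit 0) (body m 0)
    ... | suc k = refl

anyB-true : ∀ f {n k} → k < n → f k ≡ true → anyB f n ≡ true
anyB-true f {suc n} {k} (s≤s k≤n) eq with m≤n⇒m<n∨m≡n k≤n
... | inj₁ k<n = trans (cong (f n ∨_) (anyB-true f k<n eq)) (∨-zeroʳ (f n))
... | inj₂ refl rewrite eq = refl

anyB-witness : ∀ f n → anyB f n ≡ true → ∃ λ k → k < n × f k ≡ true
anyB-witness f (suc n) eq with ∨-true {f n} eq
... | inj₁ fn = n , ≤-refl , fn
... | inj₂ r with anyB-witness f n r
...   | k , k<n , fk = k , m≤n⇒m≤1+n k<n , fk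

allB-true : ∀ f n → (∀ k → k < n → f k ≡ true) → allB f n ≡ true
allB-true f zero    h = refl
allB-true f (suc n) h rewrite h n ≤-refl = allB-true f n (λ k k<n → h k (m≤n⇒m≤1+n k<n))

allB-lookup : ∀ f {n k} → allB f n ≡ true → k < n → f k ≡ true
allB-lookup f {suc n} {k} eq (s≤s k≤n) with ∧-true {f n} eq | m≤n⇒m<n∨m≡n k≤n
... | _  , r | inj₁ k<n  = allB-lookup f r k<n
... | fn , _ | inj₂ refl = fn

firstB-least : ∀ f {n k} → k < n → f k ≡ true → ∃ λ m → firstB f n ≡ suc m × m ≤ k × f m ≡ true
firstB-least f {suc n} {k} (s≤s k≤n) fk with m≤n⇒m<n∨m≡n k≤n
... | inj₁ k<n with firstB-least f k<n fk
...   | m , eq , m≤k , fm rewrite eq = m , refl , m≤k , fm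
firstB-least f {suc n} {k} (s≤s k≤n) fk | inj₂ refl with firstB f n in eq
... | zero rewrite fk = n , refl , ≤-refl , fk
... | suc m = m , refl , proj₁ (bound n eq) , proj₂ (bound n eq)
  where
  bound : ∀ n → firstB f n ≡ suc m → m ≤ n × f m ≡ true
  bound (suc n) e with firstB f n in eq'
  bound (suc n) refl | suc m' = m≤n⇒m≤1+n (proj₁ (bound n eq')) , proj₂ (bound n eq')
  bound (suc n) e | zero with f n in fn
  bound (suc n) refl | zero | true = n≤1+n n , fn

greatB-greatest : ∀ f {n k} → k < n → f k ≡ true → k ≤ greatB f n × f (greatB f n) ≡ true
greatB-greatest f {suc n} {k} (s≤s k≤n) fk with f n in fn
... | true = k≤n , fn
... | false with m≤n⇒m<n∨m≡n k≤n
...   | inj₁ k<n = greatB-greatest f k<n fk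
...   | inj₂ refl with trans (sym fn) fk
...     | ()

greatB≤ : ∀ f n → greatB f (suc n) ≤ n
greatB≤ f n with f n
... | true = ≤-refl
greatB≤ f zero    | false = z≤n
greatB≤ f (suc n) | false = m≤n⇒m≤1+n (greatB≤ f n)

greatB-< : ∀ f {n} → 0 < n → greatB f n < n
greatB-< f {suc n} _ = s≤s (greatB≤ f n)

-- Programs for bits

parityE halfE : Exp 1
parityE = `rec (v 0) (lit 0) (ifz (v 1) (lit 1) (lit 0))
halfE   = `rec (v 0) (lit 0) (ifz (call parityE (v 0 ∷ [])) (v 1) (`suc (v 1)))

parity-correct : ∀ n → ⟦ parityE ⟧ (n ∷ []) ≡ n % 2
parity-correct 0 = refl
parity-correct 1 = refl
parity-correct (suc (suc n)) with ⟦ parityE ⟧ (n ∷ []) | parity-correct n | m%n<n n 2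
... | zero        | eq | _  = eq
... | suc zero    | eq | _  = eq
... | suc (suc r) | eq | lt with subst (_< 2) (sym eq) lt
...   | s≤s (s≤s ())

half-correct : ∀ n → ⟦ halfE ⟧ (n ∷ []) ≡ ⌊ n /2⌋
half-correct 0 = refl
half-correct 1 = refl
half-correct (suc (suc n)) with ⟦ parityE ⟧ (n ∷ []) | half-correct n
... | zero        | eq = cong suc eq
... | suc _       | eq = cong suc eq

opaque
  testBitE : Exp 2
  testBitE = call parityE (`rec (v 1) (v 0) (call halfE (v 1 ∷ [])) ∷ [])

halves : ℕ → ℕ → ℕ
halves c = natrec c (λ _ → ⌊_/2⌋)

-- `testBit` halves its argument before recursing, whereas the program halves the result of its
-- recursion; iterated halving commutes with one more halving.
testBit-halves : ∀ x c → testBit c x ≡ (halves c x % 2 ≡ᵇ 1)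
testBit-halves zero    c = refl
testBit-halves (suc x) c = trans (testBit-halves x ⌊ c /2⌋) (cong (λ d → d % 2 ≡ᵇ 1) (commute x))
  where
  commute : ∀ x → halves ⌊ c /2⌋ x ≡ ⌊ halves c x /2⌋
  commute zero    = refl
  commute (suc x) = cong ⌊_/2⌋ (commute x)

opaque
  unfolding testBitE

  testBit-correct : ∀ c x → ⟦ testBitE ⟧ (c ∷ x ∷ []) ≡ toN (testBit c x)
  testBit-correct c x = trans (cong (λ d → ⟦ parityE ⟧ (d ∷ [])) (natrec-cong refl (λ _ → half-correct) x))
    (trans (parity-correct (halves c x))
      (trans (odd (halves c x % 2) (m%n<n (halves c x) 2)) (cong toN (sym (testBit-halves x c)))))
    where
    odd : ∀ r → r < 2 → r ≡ toN (r ≡ᵇ 1)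
    odd 0 _ = refl
    odd 1 _ = refl
    odd (suc (suc _)) (s≤s (s≤s ()))

-- Sequences as numbers

Sym : Set
Sym = Maybe ℕ

symOf : ℕ → Sym
symOf zero    = nothing
symOf (suc x) = just x

symOf-codeSym : ∀ a → symOf (codeSym a) ≡ a
symOf-codeSym nothing  = refl
symOf-codeSym (just x) = refl

restrict : (ℕ → Bool) → Sym → Sym
restrict d nothing  = nothing
restrict d (just x) = if d x then just x else nothing

F : (ℕ → Bool) → List Sym → List Sym
F d = map (restrict d)

drain : ∀ {A : Set} → (ℕ → A → A) → ℕ × A → ℕ × A
drain f (zero  , a) = zero , a
drain f (suc p , a) = π₂ p , f (π₁ p) a

drains : ∀ {A : Set} → (ℕ → A → A) → ℕ × A → ℕ → ℕ × A
drains f S zero    = S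
drains f S (suc t) = drain f (drains f S t)

consSym : ℕ → List Sym → List Sym
consSym a w = symOf a ∷ w

-- The sequence whose reversal is coded by i.
seq : ℕ → List Sym
seq i = proj₂ (drains consSym (i , []) i)

π₁-pair : ∀ x y → π₁ (pair x y) ≡ x
π₁-pair x y = trans (cong π₁ (sym (pr≡pair x y))) (π₁-pr x y)

π₂-pair : ∀ x y → π₂ (pair x y) ≡ y
π₂-pair x y = trans (cong π₂ (sym (pr≡pair x y))) (π₂-pr x y)

y≤pair : ∀ x y → y ≤ pair x y
y≤pair x y = subst (y ≤_) (pr≡pair x y) (y≤pr x y)

length≤codeSeq : ∀ w → length w ≤ codeSeq w
length≤codeSeq []      = z≤n
length≤codeSeq (a ∷ w) = s≤s (≤-trans (length≤codeSeq w) (y≤pair (codeSym a) (codeSeq w)))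

module _ {A : Set} (f : ℕ → A → A) where

  private
    g : A → Sym → A
    g a s = f (codeSym s) a

  -- Loop invariant: after t rounds a prefix u has been consumed, and it has length t unless the
  -- list is exhausted. As a list is no longer than its code, as many rounds as the code suffice.
  drains-codeSeq : ∀ w a t → ∃₂ λ u r → w ≡ u ++ r ×
    drains f (codeSeq w , a) t ≡ (codeSeq r , foldl g a u) × (r ≡ [] ⊎ length u ≡ t)
  drains-codeSeq w a zero = [] , w , refl , refl , inj₂ refl
  drains-codeSeq w a (suc t) with drains-codeSeq w a t
  ... | u , [] , eq , eq' , _ = u , [] , eq , cong (drain f) eq' , inj₁ refl
  ... | u , s ∷ r , eq , eq' , inj₂ len = u ++ [ s ] , r ,
        trans eq (sym (++-assoc u [ s ] r)) ,
        trans (cong (drain f) eq') (cong₂ _,_ (π₂-pair (codeSym s) (codeSeq r))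
          (trans (cong (λ x → f x (foldl g a u)) (π₁-pair (codeSym s) (codeSeq r)))
                 (sym (foldl-++ g a u [ s ])))) ,
        inj₂ (trans (length-++ u) (trans (+-comm (length u) 1) (cong suc len)))

  drained : ∀ w a → proj₂ (drains f (codeSeq w , a) (codeSeq w)) ≡ foldl g a w
  drained w a with drains-codeSeq w a (codeSeq w)
  ... | u , r , eq , eq' , fin = trans (cong proj₂ eq') (cong (foldl g a) (all r fin eq))
    where
    all : ∀ r → r ≡ [] ⊎ length u ≡ codeSeq w → w ≡ u ++ r → u ≡ w
    all []      _          eq = trans (sym (++-identityʳ u)) (sym eq)
    all (s ∷ r) (inj₂ len) eq = ⊥-elim (<-irrefl len (≤-trans
      (subst (suc (length u) ≤_) (sym (trans (cong length eq) (length-++ u)))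
        (subst (suc (length u) ≤_) (sym (+-suc (length u) (length r))) (s≤s (m≤m+n (length u) (length r)))))
      (length≤codeSeq w)))

-- A loop that takes symbols from the head of one list and puts them on the head of another reverses
-- them. Storing reversals lets `pop` prepend a sequence in its proper order.
index : List Sym → ℕ
index w = codeSeq (reverse w)

seq-index : ∀ w → seq (index w) ≡ w
seq-index w = trans (drained consSym (reverse w) [])
  (trans (reverse-foldl (λ u s → consSym (codeSym s) u) [] w) (copy w))
  where
  copy : ∀ w → foldr (λ s u → consSym (codeSym s) u) [] w ≡ w
  copy []      = refl
  copy (s ∷ w) = cong₂ _∷_ (symOf-codeSym s) (copy w)

Below : ℕ → Sym → Set
Below k a = ∀ x → a ≡ just x → x < k

-- Pairing dominates its arguments. Hence restricting `seq (π₁ k)` to a finite set depends only on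
-- that set below `k`.
seq-below : ∀ i → All (Below i) (seq i)
seq-below i = proj₂ (go i)
  where
  go : ∀ t → proj₁ (drains consSym (i , []) t) ≤ i × All (Below i) (proj₂ (drains consSym (i , []) t))
  go zero = ≤-refl , []
  go (suc t) with drains consSym (i , []) t | go t
  ... | zero  , w | le , all = z≤n , all
  ... | suc p , w | le , all = ≤-trans (π₂≤ p) (≤-trans (n≤1+n p) le) , top ∷ all
    where
    top : Below i (symOf (π₁ p))
    top x eq with π₁ p in eq'
    top x refl | suc .x = ≤-trans (subst (_≤ p) eq' (π₁≤ p)) (≤-trans (n≤1+n p) le)

-- g takes a symbol, the accumulator and a parameter.
drainE : Exp 3 → Exp 2
drainE g = ifz (`π₁ (v 0)) (v 0)
  (`pair (`π₂ (`pred (`π₁ (v 0)))) (call g (`π₁ (`pred (`π₁ (v 0))) ∷ `π₂ (v 0) ∷ v 1 ∷ [])))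

foldE : Exp 3 → Exp 3
foldE g = `π₂ (`rec (v 0) (`pair (v 0) (v 1)) (call (drainE g) (v 1 ∷ v 4 ∷ [])))

fold-correct : ∀ g i a D → ⟦ foldE g ⟧ (i ∷ a ∷ D ∷ []) ≡
  proj₂ (drains (λ s a → ⟦ g ⟧ (s ∷ a ∷ D ∷ [])) (i , a) i)
fold-correct g i a D = trans (cong π₂ (go i)) (π₂-pr _ _)
  where
  f : ℕ → ℕ → ℕ
  f s a = ⟦ g ⟧ (s ∷ a ∷ D ∷ [])
  code : ℕ × ℕ → ℕ
  code (s , a) = pr s a
  -- The body of `drainE` with both projections of the state made into variables, so that a single
  -- congruence replaces all their occurrences.
  inner : ℕ → ℕ → ℕ → ℕ
  inner S s a = ⟦ ifz (v 1) (v 0) (`pair (`π₂ (`pred (v 1))) (call g (`π₁ (`pred (v 1)) ∷ v 2 ∷ v 3 ∷ []))) ⟧ (S ∷ s ∷ a ∷ D ∷ [])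
  one-step : ∀ S → ⟦ drainE g ⟧ (code S ∷ D ∷ []) ≡ code (drain f S)
  one-step (zero  , a) = cong₂ (inner (pr 0 a)) (π₁-pr 0 a) (π₂-pr 0 a)
  one-step (suc p , a) = cong₂ (inner (pr (suc p) a)) (π₁-pr (suc p) a) (π₂-pr (suc p) a)
  go : ∀ t → natrec (pr i a) (λ y S → ⟦ drainE g ⟧ (S ∷ D ∷ [])) t ≡ code (drains f (i , a) t)
  go zero    = refl
  go (suc t) = trans (cong (λ S → ⟦ drainE g ⟧ (S ∷ D ∷ [])) (go t)) (one-step (drains f (i , a) t))

restrictE : Exp 2
restrictE = ifz (v 1) (lit 0) (`if (call testBitE (v 0 ∷ `pred (v 1) ∷ [])) (v 1) (lit 0))

restrict-correct : ∀ D a → ⟦ restrictE ⟧ (D ∷ a ∷ []) ≡ codeSym (restrict (testBit D) (symOf a))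
restrict-correct D zero = refl
restrict-correct D (suc x) with ⟦ testBitE ⟧ (D ∷ x ∷ []) | testBit-correct D x
... | _ | refl with testBit D x
...   | true  = refl
...   | false = refl

opaque
  popE : Exp 3
  popE = foldE (`suc (`pair (call restrictE (v 2 ∷ v 0 ∷ [])) (v 1)))

pop : ℕ → ℕ → ℕ → ℕ
pop D i r = ⟦ popE ⟧ (i ∷ r ∷ D ∷ [])

opaque
  unfolding popE

  pop-correct : ∀ D i w → pop D i (codeSeq w) ≡ codeSeq (F (testBit D) (seq i) ++ w)
  pop-correct D i w = trans (fold-correct (`suc (`pair (call restrictE (v 2 ∷ v 0 ∷ [])) (v 1))) i (codeSeq w) D)
    (cong proj₂ (go i))
    where
    f : ℕ → ℕ → ℕ
    f s r = suc (pr (⟦ restrictE ⟧ (D ∷ s ∷ [])) r)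
    state : ℕ × List Sym → ℕ × ℕ
    state (s , u) = s , codeSeq (F (testBit D) u ++ w)
    one-step : ∀ S → drain f (state S) ≡ state (drain consSym S)
    one-step (zero  , u) = refl
    one-step (suc p , u) = cong (π₂ p ,_) (cong suc (trans (cong (λ a → pr a _) (restrict-correct D (π₁ p))) (pr≡pair _ _)))
    go : ∀ t → drains f (i , codeSeq w) t ≡ state (drains consSym (i , []) t)
    go zero    = refl
    go (suc t) = trans (cong (drain f) (go t)) (one-step (drains consSym (i , []) t))

-- The listing D↾k. Position x holds x or a pause, so the length is k whatever the set, and only the
-- set below k matters.
can : (ℕ → Bool) → ℕ → List Sym
can d zero    = []
can d (suc k) = can d k ∷ʳ restrict d (just k)

canStepE : Exp 2
-- The counter runs downwards because symbols are prepended; `suc k` is the code of the symbol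
-- `just k`.
canStepE = `pair k (`suc (`pair (call restrictE (v 0 ∷ `suc k ∷ [])) (`π₂ (v 1))))
  where
  k : Exp 2
  k = `pred (`π₁ (v 1))

opaque
  canE : Exp 3
  canE = `π₂ (`rec (v 1) (`pair (v 1) (v 2)) (call canStepE (v 2 ∷ v 1 ∷ [])))

canon : ℕ → ℕ → ℕ → ℕ
canon D k r = ⟦ canE ⟧ (D ∷ k ∷ r ∷ [])

opaque
  unfolding canE

  canon-correct : ∀ D k w → canon D k (codeSeq w) ≡ codeSeq (can (testBit D) k ++ w)
  canon-correct D k w with go k ≤-refl
    where
    d : ℕ → Bool
    d = testBit D
    inner : ℕ → ℕ → ℕ
    inner s r = ⟦ `pair (`pred (v 0)) (`suc (`pair (call restrictE (v 2 ∷ `suc (`pred (v 0)) ∷ [])) (v 1))) ⟧ (s ∷ r ∷ D ∷ [])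
    go : ∀ t → t ≤ k → ∃₂ λ m u → m + t ≡ k × can d m ++ u ≡ can d k ++ w ×
         natrec (pr k (codeSeq w)) (λ y S → ⟦ canStepE ⟧ (D ∷ S ∷ [])) t ≡ pr m (codeSeq u)
    go zero _ = k , w , +-identityʳ k , refl , refl
    go (suc t) t<k with go t (≤-trans (n≤1+n t) t<k)
    ... | zero  , u , refl , _ , _ = ⊥-elim (<-irrefl refl t<k)
    ... | suc m , u , m+t , eq , val = m , restrict d (just m) ∷ u , trans (+-suc m t) m+t ,
          trans (sym (++-assoc (can d m) [ restrict d (just m) ] u)) eq ,
          trans (cong (λ S → ⟦ canStepE ⟧ (D ∷ S ∷ [])) val)
            (trans (cong₂ inner (π₁-pr (suc m) (codeSeq u)) (π₂-pr (suc m) (codeSeq u)))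
              (cong (pr m) (cong suc (trans (cong (λ a → pr a (codeSeq u)) (restrict-correct D (suc m))) (pr≡pair _ (codeSeq u))))))
  ... | m , u , m+k , eq , val with +-cancelʳ-≡ k m 0 m+k
  ...   | refl = trans (cong π₂ val) (trans (π₂-pr 0 (codeSeq u)) (cong codeSeq eq))

opaque
  canonNode : ℕ → ℕ → ℕ → ℕ
  canonNode D i c = pop D i (canon D c 0)

  -- The listing is cut at the whole number `k`, while only `π₁ k` names the sequence. The second
  -- component is padding: each sequence has candidates with arbitrarily long listings.
  extension : ℕ → ℕ → ℕ → ℕ
  extension D k τ = pop D (π₁ k) (canon D k (pop D τ 0))

  canonNode-correct : ∀ D i c → canonNode D i c ≡ codeSeq (F (testBit D) (seq i) ++ can (testBit D) c)
  canonNode-correct D i c = trans (cong (pop D i) (canon-correct D c []))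
    (trans (pop-correct D i _) (cong (λ w → codeSeq (F (testBit D) (seq i) ++ w)) (++-identityʳ _)))

  extension-correct : ∀ D k τ → extension D k τ ≡
    codeSeq (F (testBit D) (seq (π₁ k)) ++ (can (testBit D) k ++ F (testBit D) (seq τ)))
  extension-correct D k τ = trans (cong (λ r → pop D (π₁ k) (canon D k r)) (pop-correct D τ []))
    (trans (cong (pop D (π₁ k)) (canon-correct D k _))
      (trans (pop-correct D (π₁ k) _)
        (cong (λ w → codeSeq (F (testBit D) (seq (π₁ k)) ++ (can (testBit D) k ++ w))) (++-identityʳ _))))

`canonNode : ∀ {n} → Exp n → Exp n → Exp n → Exp n
`canonNode D i c = call popE (i ∷ call canE (D ∷ c ∷ lit 0 ∷ []) ∷ D ∷ [])

runE : Exp 2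
runE = `rec (v 0) (v 1) (call stepE (v 1 ∷ []))

-- The content-based learner and its program.

module Learner (h : ℕ) where

  busy : ℕ → ℕ
  busy S = ⟦ busyE ⟧ (S ∷ [])

  value : ℕ → ℕ → ℕ → ℕ
  value s e x = run s (ev e x 0)

  -- Within s steps each, φ_h(ρ) = e and φ_e(l) = 0.
  opaque
    denies : ℕ → ℕ → ℕ → Bool
    denies s ρ l = isZero (busy S) ∧ (isZero (busy S') ∧ isZero (val S'))
      where
      S S' : ℕ
      S = value s h ρ
      S' = value s (val S) l

    firstE : Exp 3
    firstE = call runE (v 0 ∷ `ev (lit h) (v 1) (lit 0) ∷ [])

    secondE : Exp 3
    secondE = call runE (v 0 ∷ `ev (`π₁ (`π₂ firstE)) (v 2) (lit 0) ∷ [])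

    idleE idleE′ zeroE : Exp 3
    idleE  = `isZero (call busyE (firstE ∷ []))
    idleE′ = `isZero (call busyE (secondE ∷ []))
    zeroE  = `isZero (`π₁ (`π₂ secondE))

    deniesE : Exp 3
    deniesE = `and idleE (`and idleE′ zeroE)

    denies-program : ∀ s ρ l → ⟦ deniesE ⟧ (s ∷ ρ ∷ l ∷ []) ≡ toN (denies s ρ l)
    denies-program s ρ l = `and-correct {ρ = env} idleE (`and idleE′ zeroE)
      (`isZero-correct {ρ = env} (call busyE (firstE ∷ [])) refl)
      (`and-correct {ρ = env} idleE′ zeroE
        (`isZero-correct {ρ = env} (call busyE (secondE ∷ [])) refl)
        (`isZero-correct {ρ = env} (`π₁ (`π₂ secondE)) refl))
      where
      env : Vec ℕ 3
      env = s ∷ ρ ∷ l ∷ []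

    denies-halted : ∀ s ρ l → denies s ρ l ≡ true →
      ∃ λ e → Halted (value s h ρ) e × Halted (value s e l) 0
    denies-halted s ρ l eq with ∧-true {isZero (busy (value s h ρ))} eq
    ... | b , eq' with ∧-true {isZero (busy (value s (val (value s h ρ)) l))} eq'
    ...   | b' , z = val (value s h ρ) , (isZero-true b , refl) , (isZero-true b' , isZero-true z)

    halted-denies : ∀ s ρ l {e} → Halted (value s h ρ) e → Halted (value s e l) 0 → denies s ρ l ≡ true
    halted-denies s ρ l (b , refl) (b' , z) rewrite b | b' | z = refl

    denies-mono : ∀ {s t} ρ l → s ≤ t → denies s ρ l ≡ true → denies t ρ l ≡ true
    denies-mono {s} {t} ρ l s≤t eq with denies-halted s ρ l eq
    ... | e , H , H' = halted-denies t ρ l (run-halted-≤ s≤t H) (run-halted-≤ s≤t H')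

    -- No derivation is extracted from the runs behind the denial. Instead the given derivations
    -- yield halted runs, and by uniqueness their final value 1 would equal 0.
    denies-sound : ∀ s {ρ e l} → φ h ρ e → φ e l 1 → denies s ρ l ≡ true → ⊥
    denies-sound s {ρ} {e} {l} D D' eq with denies-halted s ρ l eq | φ-halted {h} {ρ} D | φ-halted {e} {l} D'
    ... | e' , H , H' | t , K | t' , K' with run-halted-unique {s} {t} H K
    ...   | refl with run-halted-unique {s} {t'} H' K'
    ...     | ()

    denies-complete : ∀ {ρ e l} → φ h ρ e → φ e l 0 → ∃ λ s → denies s ρ l ≡ true
    denies-complete {ρ} {e} {l} D D' with φ-halted {h} {ρ} D | φ-halted {e} {l} D'
    ... | s , H | t , H' = s ⊔ t , halted-denies (s ⊔ t) ρ l
          (run-halted-≤ (m≤m⊔n s t) H) (run-halted-≤ (m≤n⊔m s t) H')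

  -- All parts of `extension` are restricted to `D`, so a dispute exhibits a sequence over every
  -- language containing `D` on which h is wrong for that language.
  disputed : ℕ → ℕ → ℕ → Bool
  disputed D n k = anyB (λ τ → anyB (λ l → testBit D l ∧ denies n (extension D k τ) l) (suc n)) (suc n)

  confirmed : ℕ → ℕ → ℕ → ℕ → Bool
  confirmed D n i c = allB (λ y → testBit D y ∨ denies n (canonNode D i c) y) c

  -- `pred` removes the offset of `firstB`. If every k up to n is disputed the value is 0;
  -- `converges` shows that this case stops occurring.
  candidate : ℕ → ℕ → ℕ
  candidate D n = pred (firstB (λ k → not (disputed D n k)) (suc n))

  nodeFor : ℕ → ℕ → ℕ → ℕ
  nodeFor D n i = canonNode D i (greatB (confirmed D n i) (suc n))

  node : ℕ → ℕ → ℕ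
  node D n = nodeFor D n (π₁ (candidate D n))

  extensionE : Exp 5
  extensionE = call popE (`π₁ (v 2) ∷ call canE (v 3 ∷ v 2 ∷ call popE (v 1 ∷ lit 0 ∷ v 3 ∷ []) ∷ []) ∷ v 3 ∷ [])

  listedE refutedE : Exp 5
  listedE  = call testBitE (v 3 ∷ v 0 ∷ [])
  refutedE = call deniesE (v 4 ∷ extensionE ∷ v 0 ∷ [])

  disputedE : Exp 3
  disputedE = `any (`any (`and listedE refutedE) (`suc (v 3))) (`suc (v 2))

  opaque
    unfolding canonNode extension

    disputed-program : ∀ D n k → ⟦ disputedE ⟧ (k ∷ D ∷ n ∷ []) ≡ toN (disputed D n k)
    disputed-program D n k = `any-correct (`any (`and listedE refutedE) (`suc (v 3))) {ρ = k ∷ D ∷ n ∷ []}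
      (λ τ → `any-correct (`and listedE refutedE) {ρ = τ ∷ k ∷ D ∷ n ∷ []}
         (λ l → `and-correct {ρ = l ∷ τ ∷ k ∷ D ∷ n ∷ []} listedE refutedE
                  (testBit-correct D l) (denies-program n (extension D k τ) l))
         (`suc (v 3)) refl)
      (`suc (v 2)) refl

  settledE : Exp 5
  settledE = `or (call testBitE (v 3 ∷ v 0 ∷ [])) (call deniesE (v 4 ∷ `canonNode (v 3) (v 2) (v 1) ∷ v 0 ∷ []))

  confirmedE : Exp 4
  confirmedE = `all settledE (v 0)

  opaque
    unfolding canonNode extension

    confirmed-program : ∀ D n i c → ⟦ confirmedE ⟧ (c ∷ i ∷ D ∷ n ∷ []) ≡ toN (confirmed D n i c)
    confirmed-program D n i c = `all-correct settledE {ρ = c ∷ i ∷ D ∷ n ∷ []}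
      (λ y → `or-correct {ρ = y ∷ c ∷ i ∷ D ∷ n ∷ []} (call testBitE (v 3 ∷ v 0 ∷ []))
               (call deniesE (v 4 ∷ `canonNode (v 3) (v 2) (v 1) ∷ v 0 ∷ []))
               (testBit-correct D y) (denies-program n (canonNode D i c) y))
      (v 0) refl

  candidateE : Exp 2
  candidateE = `pred (`first (`not disputedE) (`suc (v 1)))

  candidate-program : ∀ D n → ⟦ candidateE ⟧ (D ∷ n ∷ []) ≡ candidate D n
  candidate-program D n = trans
    (cong (λ x → ⟦ `pred (v 0) ⟧ (x ∷ []))
      (`first-correct (`not disputedE) {ρ = D ∷ n ∷ []} (λ k → `not-correct {ρ = k ∷ D ∷ n ∷ []} disputedE (disputed-program D n k)) (`suc (v 1)) refl))
    (pred-correct (firstB (λ k → not (disputed D n k)) (suc n)))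
    where
    pred-correct : ∀ m → ⟦ `pred (v 0) ⟧ (m ∷ []) ≡ pred m
    pred-correct zero    = refl
    pred-correct (suc m) = refl

  nodeForE : Exp 3
  nodeForE = `canonNode (v 1) (v 0) (`great confirmedE (`suc (v 2)))

  opaque
    unfolding canonNode extension

    nodeFor-program : ∀ D n i → ⟦ nodeForE ⟧ (i ∷ D ∷ n ∷ []) ≡ nodeFor D n i
    nodeFor-program D n i = cong (canonNode D i)
      (`great-correct confirmedE {ρ = i ∷ D ∷ n ∷ []} (confirmed-program D n i) (`suc (v 2)) refl)

  nodeE : Exp 2
  nodeE = call nodeForE (`π₁ candidateE ∷ v 0 ∷ v 1 ∷ [])

  node-program : ∀ D n → ⟦ nodeE ⟧ (D ∷ n ∷ []) ≡ node D n
  node-program D n = trans (cong (λ k → ⟦ nodeForE ⟧ (π₁ k ∷ D ∷ n ∷ [])) (candidate-program D n))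
    (nodeFor-program D n (π₁ (candidate D n)))

-- Eventual properties and slow bounds.

bool-cases : ∀ b → b ≡ true ⊎ b ≡ false
bool-cases true  = inj₁ refl
bool-cases false = inj₂ refl

T-true : ∀ {b} → T b → b ≡ true
T-true {true} _ = refl

not-true : ∀ {b} → not b ≡ true → b ≡ false
not-true {false} _ = refl

Eventually : (ℕ → Set) → Set
Eventually P = ∃ λ N → ∀ n → N ≤ n → P n

ev-map : ∀ {P Q : ℕ → Set} → (∀ n → P n → Q n) → Eventually P → Eventually Q
ev-map f (N , p) = N , λ n le → f n (p n le)

ev-× : ∀ {P Q : ℕ → Set} → Eventually P → Eventually Q → Eventually (λ n → P n × Q n)
ev-× (N , p) (M , q) = N ⊔ M , λ n le →
  p n (≤-trans (m≤m⊔n N M) le) , q n (≤-trans (m≤n⊔m N M) le)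

ev-all : ∀ {Q : ℕ → ℕ → Set} k → (∀ y → Eventually (λ n → Q n y)) →
         Eventually (λ n → ∀ y → y < k → Q n y)
ev-all zero    e = 0 , λ n _ y ()
ev-all {Q} (suc k) e = ev-map join (ev-× (e k) (ev-all k e))
  where
  join : ∀ n → Q n k × (∀ y → y < k → Q n y) → ∀ y → y < suc k → Q n y
  join n (q , qs) y (s≤s y≤k) with m≤n⇒m<n∨m≡n y≤k
  ... | inj₁ y<k  = qs y y<k
  ... | inj₂ refl = q

-- slow n tends to infinity, but so slowly that P n (slow n) holds for every n.
module Slow {P : ℕ → ℕ → Set} (p₀ : ∀ n → P n 0) (ev : ∀ y → Eventually (λ n → P n y)) where

  opaque
    slow : ℕ → ℕ
    slow zero    = 0
    slow (suc n) = if proj₁ (ev (suc (slow n))) ≤ᵇ suc n then suc (slow n) else slow n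

    slow-valid : ∀ n → P n (slow n)
    slow-valid n with inv n
      where
      inv : ∀ n → slow n ≡ 0 ⊎ proj₁ (ev (slow n)) ≤ n
      inv zero = inj₁ refl
      inv (suc n) with proj₁ (ev (suc (slow n))) ≤ᵇ suc n in eq
      ... | true  = inj₂ (≤ᵇ⇒≤ _ _ (subst T (sym eq) _))
      ... | false with inv n
      ...   | inj₁ z  = inj₁ z
      ...   | inj₂ le = inj₂ (m≤n⇒m≤1+n le)
    ... | inj₁ z  = subst (P n) (sym z) (p₀ n)
    ... | inj₂ le = proj₂ (ev (slow n)) n le

    slow-step : ∀ n → slow n ≤ slow (suc n)
    slow-step n with proj₁ (ev (suc (slow n))) ≤ᵇ suc n
    ... | true  = n≤1+n _
    ... | false = ≤-refl

    slow-mono : ∀ {m n} → m ≤ n → slow m ≤ slow n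
    slow-mono m≤n = go (≤⇒≤′ m≤n)
      where
      go : ∀ {m n} → m ≤′ n → slow m ≤ slow n
      go ≤′-refl       = ≤-refl
      go (≤′-step m≤n) = ≤-trans (go m≤n) (slow-step _)

    slow≤ : ∀ n → slow n ≤ n
    slow≤ zero = z≤n
    slow≤ (suc n) with proj₁ (ev (suc (slow n))) ≤ᵇ suc n
    ... | true  = s≤s (slow≤ n)
    ... | false = m≤n⇒m≤1+n (slow≤ n)

    slow-unbounded : ∀ y → Eventually (λ n → y ≤ slow n)
    slow-unbounded y = proj₁ (reach y) , λ n le → ≤-trans (proj₂ (reach y)) (slow-mono le)
      where
      reach : ∀ y → ∃ λ n → y ≤ slow n
      reach zero = 0 , z≤n
      reach (suc y) with reach y
      -- Wait until the threshold for y + 1 has passed as well. Either the bound exceeds y already,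
      -- or it equals y and the next step raises it.
      ... | n , le with m≤n⇒m<n∨m≡n (≤-trans le (slow-mono (m≤m⊔n n (proj₁ (ev (suc y))))))
      ...   | inj₁ lt = n ⊔ proj₁ (ev (suc y)) , lt
      ...   | inj₂ eq = suc m , bump
        where
        m : ℕ
        m = n ⊔ proj₁ (ev (suc y))
        bump : suc y ≤ slow (suc m)
        bump with proj₁ (ev (suc (slow m))) ≤ᵇ suc m in eq'
        ... | true  = s≤s (≤-reflexive eq)
        ... | false = ⊥-elim (subst T eq' (≤⇒≤ᵇ {proj₁ (ev (suc (slow m)))} {suc m}
                        (subst (λ z → proj₁ (ev (suc z)) ≤ suc m) eq
                          (m≤n⇒m≤1+n (m≤n⊔m n (proj₁ (ev (suc y))))))))

-- Lists of symbols

record In (d : ℕ → Bool) (a : Sym) : Set where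
  constructor mkIn
  field listed : ∀ x → a ≡ just x → d x ≡ true
open In

restrict-In : ∀ d a → In d (restrict d a)
restrict-In d nothing  = mkIn λ x ()
restrict-In d (just y) with d y in dy
... | true  = mkIn λ { x refl → dy }
... | false = mkIn λ x ()

restrict-id : ∀ {d a} → In d a → restrict d a ≡ a
restrict-id {a = nothing} i = refl
restrict-id {a = just x}  i rewrite listed i x refl = refl

F-In : ∀ d w → All (In d) (F d w)
F-In d []      = []
F-In d (a ∷ w) = restrict-In d a ∷ F-In d w

F-id : ∀ {d w} → All (In d) w → F d w ≡ w
F-id []       = refl
F-id (i ∷ is) = cong₂ _∷_ (restrict-id i) (F-id is)

can-In : ∀ d k → All (In d) (can d k)
can-In d zero    = []
can-In d (suc k) = ++⁺ (can-In d k) (restrict-In d (just k) ∷ [])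

length-can : ∀ d k → length (can d k) ≡ k
length-can d zero    = refl
length-can d (suc k) = trans (length-++ (can d k)) (trans (+-comm _ 1) (cong suc (length-can d k)))

Agree : ℕ → (ℕ → Bool) → (ℕ → Bool) → Set
Agree k d d' = ∀ x → x < k → d x ≡ d' x

restrict-agree : ∀ {k d d'} → Agree k d d' → ∀ {a} → Below k a → restrict d a ≡ restrict d' a
restrict-agree ag {nothing} b = refl
restrict-agree ag {just x}  b rewrite ag x (b x refl) = refl

F-agree : ∀ {k d d'} → Agree k d d' → ∀ {w} → All (Below k) w → F d w ≡ F d' w
F-agree ag []       = refl
F-agree ag (b ∷ bs) = cong₂ _∷_ (restrict-agree ag b) (F-agree ag bs)

can-agree : ∀ k {d d'} → Agree k d d' → can d k ≡ can d' k
can-agree zero    ag = refl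
can-agree (suc k) ag = cong₂ _∷ʳ_ (can-agree k (λ x lt → ag x (m≤n⇒m≤1+n lt)))
  (restrict-agree ag {just k} λ { x refl → ≤-refl })

_⊑_ : List Sym → List Sym → Set
u ⊑ w = ∃ λ r → w ≡ u ++ r

⊑-refl : ∀ {w} → w ⊑ w
⊑-refl {w} = [] , sym (++-identityʳ w)

⊑-trans : ∀ {u v w} → u ⊑ v → v ⊑ w → u ⊑ w
⊑-trans {u} (r , refl) (s , refl) = r ++ s , ++-assoc u r s

⊑-++ : ∀ u {v w} → v ⊑ w → (u ++ v) ⊑ (u ++ w)
⊑-++ u {v} (r , refl) = r , sym (++-assoc u v r)

⊑-length : ∀ {u w} → u ⊑ w → length u ≤ length w
⊑-length {u} (r , refl) = subst (length u ≤_) (sym (length-++ u)) (m≤m+n _ _)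

can-⊑ : ∀ d {m n} → m ≤ n → can d m ⊑ can d n
can-⊑ d m≤n = go (≤⇒≤′ m≤n)
  where
  go : ∀ {m n} → m ≤′ n → can d m ⊑ can d n
  go ≤′-refl       = ⊑-refl
  go (≤′-step m≤n) = ⊑-trans (go m≤n) (_ , refl)

at : List Sym → ℕ → Sym
at []      _       = nothing
at (a ∷ w) zero    = a
at (a ∷ w) (suc q) = at w q

at-⊑ : ∀ {u w q} → u ⊑ w → q < length u → at w q ≡ at u q
at-⊑ {a ∷ u} {q = zero}  (r , refl) lt       = refl
at-⊑ {a ∷ u} {q = suc q} (r , refl) (s≤s lt) = at-⊑ {u} (r , refl) lt

at-All : ∀ {P : Sym → Set} {w q} → All P w → q < length w → P (at w q)
at-All {q = zero}  (p ∷ _)  _        = p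
at-All {q = suc q} (_ ∷ ps) (s≤s lt) = at-All ps lt

applyUpTo-at : ∀ u (f : ℕ → Sym) → (∀ q → q < length u → f q ≡ at u q) → applyUpTo f (length u) ≡ u
applyUpTo-at []      f h = refl
applyUpTo-at (a ∷ u) f h = cong₂ _∷_ (h 0 (s≤s z≤n)) (applyUpTo-at u (f ∘ suc) (λ q lt → h (suc q) (s≤s lt)))

at-snoc : ∀ u a {k} → length u ≡ k → at (u ∷ʳ a) k ≡ a
at-snoc []      a refl = refl
at-snoc (_ ∷ u) a refl = at-snoc u a refl

at-++ʳ : ∀ u {w} q → at (u ++ w) (length u + q) ≡ at w q
at-++ʳ []      q = refl
at-++ʳ (_ ∷ u) q = at-++ʳ u q

at-can : ∀ d k x → x < k → d x ≡ true → at (can d k) x ≡ just x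
at-can d (suc k) x (s≤s x≤k) dx with m≤n⇒m<n∨m≡n x≤k
... | inj₁ x<k  = trans (at-⊑ {can d k} (_ , refl) (subst (x <_) (sym (length-can d k)) x<k)) (at-can d k x x<k dx)
... | inj₂ refl = trans (at-snoc (can d x) _ (length-can d x)) (cong (if_then just x else nothing) dx)

-- Convergence of the content-based learner

module Convergence
  -- `lb` decides the language, `Good ρ` stands for h being right on the sequence coded by ρ, and
  -- `D n` for the content of the first n entries of the text at hand.
  (h : ℕ) (lb : ℕ → Bool) (Good : ℕ → Set)
  (good-in  : ∀ {ρ l} s → Good ρ → lb l ≡ true → Learner.denies h s ρ l ≡ true → ⊥)
  (good-out : ∀ {ρ l} → Good ρ → lb l ≡ false → ∃ λ s → Learner.denies h s ρ l ≡ true)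
  (learn : ∀ (U : Text) → (∀ x → lb x ≡ true → ∃ λ n → U n ≡ just x) → (∀ n → In lb (U n)) →
           Eventually (λ n → Good (codeSeq (initSeg U n))))
  (D : ℕ → ℕ)
  (D-mono : ∀ {m n} x → m ≤ n → testBit (D m) x ≡ true → testBit (D n) x ≡ true)
  (D-sound : ∀ n x → testBit (D n) x ≡ true → lb x ≡ true)
  (D-complete : ∀ x → lb x ≡ true → ∃ λ n → testBit (D n) x ≡ true)
  where

  open Learner h

  d : ℕ → ℕ → Bool
  d n = testBit (D n)

  -- Finite approximations of one text for the language. Since `can lb y` has length y, `covers`
  -- both brings in all elements below y and makes the lengths unbounded.
  record Chain (w : ℕ → List Sym) : Set where
    field
      grows  : ∀ n → w n ⊑ w (suc n)
      sound  : ∀ n → All (In lb) (w n)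
      covers : ∀ y → ∃₂ λ n u → (u ++ can lb y) ⊑ w n

  module _ {w : ℕ → List Sym} (C : Chain w) where
    open Chain C

    chain-mono : ∀ {m n} → m ≤ n → w m ⊑ w n
    chain-mono m≤n = go (≤⇒≤′ m≤n)
      where
      go : ∀ {m n} → m ≤′ n → w m ⊑ w n
      go ≤′-refl       = ⊑-refl
      go (≤′-step m≤n) = ⊑-trans (go m≤n) (grows _)

    chain-long : ∀ q → ∃ λ n → q ≤ length (w n)
    chain-long q with covers q
    ... | n , u , p = n , ≤-trans (subst (q ≤_) (sym (trans (length-++ u) (cong (length u +_) (length-can lb q)))) (m≤n+m q (length u))) (⊑-length p)

    opaque
      -- The limit U reads its entry q from a member of the chain that is longer than q; by growth
      -- the choice is immaterial. Convergence of h on U then speaks about all long prefixes of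
      -- members.
      chain-learn : ∃ λ M → ∀ {u n} → u ⊑ w n → M ≤ length u → Good (codeSeq u)
      chain-learn = proj₁ learned , λ {u} {n} p le →
        subst (λ v → Good (codeSeq v)) (segment u n p) (proj₂ learned (length u) le)
        where
        N : ℕ → ℕ
        N q = proj₁ (chain-long (suc q))
        U : Text
        U q = at (w (N q)) q
        U-at : ∀ n q → q < length (w n) → U q ≡ at (w n) q
        U-at n q lt with ≤-total n (N q)
        ... | inj₁ le = at-⊑ (chain-mono le) lt
        ... | inj₂ le = sym (at-⊑ (chain-mono le) (proj₂ (chain-long (suc q))))
        segment : ∀ u n → u ⊑ w n → initSeg U (length u) ≡ u
        segment u n p = trans (map-upTo U (length u)) (applyUpTo-at u U (λ q lt →
          trans (U-at n q (≤-trans lt (⊑-length p))) (at-⊑ p lt)))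
        learned : Eventually (λ n → Good (codeSeq (initSeg U n)))
        learned = learn U exhaust (λ q → at-All (sound (N q)) (proj₂ (chain-long (suc q))))
          where
          exhaust : ∀ x → lb x ≡ true → ∃ λ n → U n ≡ just x
          exhaust x lx with covers (suc x)
          ... | n , u , p = length u + x , trans (U-at n _ (≤-trans lt (⊑-length p)))
                  (trans (at-⊑ p lt) (trans (at-++ʳ u x) (at-can lb (suc x) x ≤-refl lx)))
            where
            lt : length u + x < length (u ++ can lb (suc x))
            lt = subst (length u + x <_) (sym (trans (length-++ u) (cong (length u +_) (length-can lb (suc x)))))
                   (+-monoʳ-< (length u) ≤-refl)

  D-In : ∀ {n a} → In (d n) a → In lb a
  D-In {n} i = mkIn λ x eq → D-sound n x (listed i x eq)

  eventually-listed : ∀ x → Eventually (λ n → d n x ≡ lb x)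
  eventually-listed x with bool-cases (lb x)
  ... | inj₁ lx = proj₁ (D-complete x lx) , λ n le → trans (D-mono x le (proj₂ (D-complete x lx))) (sym lx)
  ... | inj₂ lx = 0 , λ n _ → trans (unlisted n) (sym lx)
    where
    unlisted : ∀ n → d n x ≡ false
    unlisted n with bool-cases (d n x)
    ... | inj₂ e = e
    ... | inj₁ e with trans (sym (D-sound n x e)) lx
    ...   | ()

  eventually-agree : ∀ k → Eventually (λ n → Agree k (d n) lb)
  eventually-agree k = ev-all k eventually-listed

  refuted : ∀ {ρ} l s n → d n l ≡ true → denies s ρ l ≡ true → Good ρ → ⊥
  refuted l s n dl z g = good-in s g (D-sound n l dl) z

  -- Below `complete n` the set coded by `D n` already agrees with the language.
  open Slow {λ n y → Agree y (d n) lb} (λ n x ()) eventually-agree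
    using () renaming (slow to complete; slow-valid to complete-valid; slow-step to complete-step;
              slow-mono to complete-mono; slow-unbounded to complete-unbounded)

  -- Each candidate is eventually right or disputed.

  module Settle (k : ℕ) where

    i : ℕ
    i = π₁ k

    σ : List Sym
    σ = F lb (seq i)

    c : ℕ → ℕ
    c n = greatB (confirmed (D n) n i) (suc n)

    nodeL : ℕ → List Sym
    nodeL n = F (d n) (seq i) ++ can (d n) (c n)

    escapes : ℕ → Bool
    escapes n = anyB (λ l → lb l ∧ not (d n l)) (c n)

    opaque
      -- The confirmed sequence has a pause in place of an element of the language not yet listed.
      -- Confirmation then means that h denies this element there, so h is wrong on a sequence over
      -- the language. The condition on `k` makes the sequence start with `σ`.
      event : ℕ → Bool
      event n = (k ≤ᵇ complete n) ∧ (confirmed (D n) n i (c n) ∧ escapes n)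

    record Event (n : ℕ) : Set where
      field
        k≤     : k ≤ complete n
        l      : ℕ
        l<c    : l < c n
        l∈     : lb l ≡ true
        l∉     : d n l ≡ false
        denied : denies n (canonNode (D n) i (c n)) l ≡ true

    opaque
      unfolding event

      event-data : ∀ n → event n ≡ true → Event n
      event-data n e with ∧-true {k ≤ᵇ complete n} e
      ... | a , e' with ∧-true {confirmed (D n) n i (c n)} e'
      ...   | conf , esc with anyB-witness (λ l → lb l ∧ not (d n l)) (c n) esc
      ...     | l , l<c , both with ∧-true {lb l} both
      ...       | l∈ , l∉ = record { k≤ = ≤ᵇ⇒≤ _ _ (subst T (sym a) _) ; l = l ; l<c = l<c ; l∈ = l∈ ; l∉ = unlisted ; denied = den }
        where
        unlisted : d n l ≡ false
        unlisted = not-true l∉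
        den : denies n (canonNode (D n) i (c n)) l ≡ true
        den with ∨-true {d n l} (allB-lookup (λ y → d n y ∨ denies n (canonNode (D n) i (c n)) y) conf l<c)
        ... | inj₂ z = z
        ... | inj₁ y with trans (sym y) unlisted
        ...   | ()

      quiet : ∀ n → event n ≡ false → k ≤ complete n → confirmed (D n) n i (c n) ≡ true → escapes n ≡ false
      quiet n e k≤ conf = trans (sym (cong₂ (λ a b → a ∧ (b ∧ escapes n)) (T-true (≤⇒≤ᵇ k≤)) conf)) e

    σ-agree : ∀ {n} → k ≤ complete n → F (d n) (seq i) ≡ σ
    σ-agree {n} le = F-agree {k} (λ x lt → complete-valid n x (≤-trans lt le))
      (All.map (λ b x eq → ≤-trans (b x eq) (π₁≤ k)) (seq-below i))

    -- The element passed over lies below `c n`, but not below `complete n`, where nothing is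
    -- missing.
    complete<c : ∀ {n} → Event n → complete n ≤ c n
    complete<c {n} E with ≤-total (complete n) (Event.l E)
    ... | inj₁ le = ≤-trans le (≤-trans (n≤1+n _) (Event.l<c E))
    ... | inj₂ le with m≤n⇒m<n∨m≡n le
    ...   | inj₂ eq = ≤-trans (≤-reflexive (sym eq)) (≤-trans (n≤1+n _) (Event.l<c E))
    ...   | inj₁ lt with trans (sym (Event.l∉ E)) (trans (complete-valid n _ lt) (Event.l∈ E))
    ...     | ()

    -- As k ≤ `complete n` ≤ `c n`, the node is `σ`, the listing up to `k` and a rest r. Once the
    -- denied element is listed and the bounds on τ and l are large enough, τ = `index r` disputes
    -- `k`: later stages rebuild the same sequence, and denials persist.
    event-disputed : ∀ n → Event n → Eventually (λ m → disputed (D m) m k ≡ true)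
    event-disputed n E with can-⊑ (d n) (≤-trans (Event.k≤ E) (complete<c E))
    ... | r , eq = ev-map dispute (ev-× (n , λ m le → le) (ev-× (index r , λ m le → le)
                     (ev-× (Event.l E , λ m le → le) (eventually-listed (Event.l E)))))
      where
      open Event E
      dispute : ∀ m → n ≤ m × index r ≤ m × l ≤ m × d m l ≡ lb l → disputed (D m) m k ≡ true
      dispute m (n≤m , r≤m , l≤m , dl) = anyB-true _ (s≤s r≤m) (anyB-true _ (s≤s l≤m)
        (cong₂ _∧_ (trans dl l∈) (subst (λ ρ → denies m ρ l ≡ true) same (denies-mono _ l n≤m denied))))
        where
        r-In : All (In (d m)) r
        r-In = All.map (λ i → mkIn λ x eq → D-mono x n≤m (listed i x eq)) (++⁻ʳ (can (d n) k) (subst (All (In (d n))) eq (can-In (d n) (c n))))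
        agree : ∀ x → x < k → d n x ≡ d m x
        agree x lt = trans (complete-valid n x (≤-trans lt k≤))
          (sym (complete-valid m x (≤-trans lt (≤-trans k≤ (complete-mono n≤m)))))
        same : canonNode (D n) i (c n) ≡ extension (D m) k (index r)
        same = trans (canonNode-correct (D n) i (c n)) (trans
          (cong codeSeq (cong₂ _++_
            (trans (σ-agree k≤) (sym (σ-agree (≤-trans k≤ (complete-mono n≤m)))))
            (trans eq (cong₂ _++_ (can-agree k agree) (sym (trans (cong (F (d m)) (seq-index r)) (F-id r-In)))))))
          (sym (extension-correct (D m) k (index r))))

    first : ℕ → ℕ
    first = firstB event

    -- Before any event the language is listed only up to `complete n`, so the text can still turn
    -- into the node of an event at n. After the turn at m the listing restarts behind that node and
    -- goes on without bound.
    w′ : ℕ → ℕ → List Sym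
    w′ n zero    = σ ++ can lb (complete n)
    w′ n (suc m) = nodeL m ++ can lb n

    w : ℕ → List Sym
    w n = w′ n (first n)

    extends : ∀ n → Event n → (σ ++ can lb (complete n)) ⊑ nodeL n
    extends n E = subst ((σ ++ can lb (complete n)) ⊑_)
      (cong (_++ can (d n) (c n)) (sym (σ-agree (Event.k≤ E))))
      (⊑-++ σ (subst (_⊑ can (d n) (c n)) (can-agree (complete n) (complete-valid n))
        (can-⊑ (d n) (complete<c E))))

    first-event : ∀ n {m} → first n ≡ suc m → m < n × event m ≡ true
    first-event (suc n) eq with first n in eq'
    first-event (suc n) refl | suc m = m≤n⇒m≤1+n (proj₁ (first-event n eq')) , proj₂ (first-event n eq')
    first-event (suc n) eq | zero with event n in e
    first-event (suc n) refl | zero | true = ≤-refl , e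

    first-none : ∀ n → first n ≡ 0 → event n ≡ false → first (suc n) ≡ 0
    first-none n f0 e rewrite f0 | e = refl

    chain : Chain w
    chain = record { grows = grows ; sound = λ n → sound n (first n) ; covers = covers }
      where
      grows : ∀ n → w n ⊑ w (suc n)
      grows n with first n
      ... | suc m = ⊑-++ (nodeL m) (can-⊑ lb (n≤1+n n))
      ... | zero with event n in e
      ...   | true  = ⊑-trans (extends n (event-data n e)) (_ , refl)
      ...   | false = ⊑-++ σ (can-⊑ lb (complete-step n))
      sound : ∀ n f → All (In lb) (w′ n f)
      sound n zero    = ++⁺ (F-In lb (seq i)) (can-In lb (complete n))
      sound n (suc m) = ++⁺ (++⁺ (All.map (D-In {m}) (F-In (d m) (seq i))) (All.map (D-In {m}) (can-In (d m) (c m)))) (can-In lb n)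
      covers : ∀ y → ∃₂ λ n u → (u ++ can lb y) ⊑ w n
      covers y = go (first n) refl
        where
        n : ℕ
        n = y ⊔ proj₁ (complete-unbounded y)
        go : ∀ f → first n ≡ f → ∃₂ λ n u → (u ++ can lb y) ⊑ w n
        go zero eq = n , σ , subst (λ f → (σ ++ can lb y) ⊑ w′ n f) (sym eq)
          (⊑-++ σ (can-⊑ lb (proj₂ (complete-unbounded y) n (m≤n⊔m y _))))
        go (suc m) eq = n , nodeL m , subst (λ f → (nodeL m ++ can lb y) ⊑ w′ n f) (sym eq)
          (⊑-++ (nodeL m) (can-⊑ lb (m≤m⊔n y _)))

    M : ℕ
    M = proj₁ (chain-learn chain)

    good-prefix : ∀ {u n} → u ⊑ w n → M ≤ length u → Good (codeSeq u)
    good-prefix {u} {n} = proj₂ (chain-learn chain) {u} {n}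

    nodeL-long : ∀ n → c n ≤ length (nodeL n)
    nodeL-long n = subst (c n ≤_) (sym (trans (length-++ (F (d n) (seq i))) (cong (length (F (d n) (seq i)) +_) (length-can (d n) (c n)))))
      (m≤n+m (c n) _)

    -- The text would turn into `nodeL n`, making it a prefix of length at least `M`, hence good;
    -- but an event means that h denies an element there.
    no-late-event : ∀ n → M ≤ complete n → first n ≡ 0 → event n ≡ true → ⊥
    no-late-event n M≤ f0 e = refuted-here (good-prefix {nodeL n} {suc n} prefix
        (≤-trans (≤-trans M≤ (complete<c E)) (nodeL-long n)))
      where
      E : Event n
      E = event-data n e
      prefix : nodeL n ⊑ w (suc n)
      prefix rewrite f0 | e = _ , refl
      refuted-here : Good (codeSeq (nodeL n)) → ⊥
      refuted-here g = good-in n (subst Good (sym (canonNode-correct (D n) i (c n))) g) (Event.l∈ E) (Event.denied E)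

    -- It is enough to inspect the moments before `n₀`. An event there makes `k` disputed. Otherwise
    -- there is never one, so the text is `σ` followed by the canonical listing, and a large
    -- confirmed `c n` without escapes gives one of its long prefixes.
    settles : Eventually (λ n → disputed (D n) n k ≡ true ⊎ Good (nodeFor (D n) n i))
    settles = go (first n₀) refl
      where
      n₀ : ℕ
      n₀ = proj₁ (complete-unbounded M)
      go : ∀ f → first n₀ ≡ f → Eventually (λ n → disputed (D n) n k ≡ true ⊎ Good (nodeFor (D n) n i))
      go (suc m) eq = ev-map (λ _ → inj₁) (event-disputed m (event-data m (proj₂ (first-event n₀ eq))))
      go zero eq = ev-map (λ n → inj₂ ∘ good n)
          (ev-× (n₀ , λ n le → no-event n le) (ev-× (complete-unbounded (M ⊔ k)) (ev-× (M , λ n le → le) M-confirmed)))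
        where
        never′ : ∀ {n} → n₀ ≤′ n → first n ≡ 0
        never′ ≤′-refl = eq
        never′ (≤′-step {n} le) with bool-cases (event n)
        ... | inj₁ e = ⊥-elim (no-late-event n (proj₂ (complete-unbounded M) n (≤′⇒≤ le)) (never′ le) e)
        ... | inj₂ e = first-none n (never′ le) e
        no-event : ∀ n → n₀ ≤ n → event n ≡ false
        no-event n le with bool-cases (event n)
        ... | inj₁ e = ⊥-elim (no-late-event n (proj₂ (complete-unbounded M) n le) (never′ (≤⇒≤′ le)) e)
        ... | inj₂ e = e
        standard : ∀ y → M ≤ y → Good (codeSeq (σ ++ can lb y))
        standard y M≤y = good-prefix {σ ++ can lb y} {n} (subst (λ f → (σ ++ can lb y) ⊑ w′ n f) (sym (never′ (≤⇒≤′ (m≤m⊔n n₀ _))))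
            (⊑-++ σ (can-⊑ lb (proj₂ (complete-unbounded y) n (m≤n⊔m n₀ _)))))
            (≤-trans M≤y (subst (y ≤_) (sym (trans (length-++ σ) (cong (length σ +_) (length-can lb y)))) (m≤n+m y _)))
          where
          n : ℕ
          n = n₀ ⊔ proj₁ (complete-unbounded y)
        canonNode-standard : ∀ n y → k ≤ complete n → Agree y (d n) lb → canonNode (D n) i y ≡ codeSeq (σ ++ can lb y)
        canonNode-standard n y le ag = trans (canonNode-correct (D n) i y)
          (cong codeSeq (cong₂ _++_ (σ-agree le) (can-agree y ag)))
        Settled : ℕ → ℕ → Set
        Settled n y = d n y ∨ denies n (codeSeq (σ ++ can lb M)) y ≡ true
        settled : ∀ y → Eventually (λ n → Settled n y)
        settled y with bool-cases (lb y)
        ... | inj₁ ly = ev-map (λ n e → cong (_∨ denies n (codeSeq (σ ++ can lb M)) y) (trans e ly)) (eventually-listed y)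
        ... | inj₂ ly with good-out (standard M ≤-refl) ly
        ...   | s , z = s , λ n le → trans (cong (d n y ∨_) (denies-mono _ y le z)) (∨-zeroʳ (d n y))
        -- h is right on `σ` followed by the listing up to `M`, so each of the finitely many
        -- non-elements below `M` is denied in time. Hence the largest confirmed length is at least
        -- `M`.
        M-confirmed : Eventually (λ n → confirmed (D n) n i M ≡ true)
        M-confirmed = ev-map (λ { n (le , all) → allB-true _ M (λ y lt →
            subst (λ ρ → d n y ∨ denies n ρ y ≡ true)
              (sym (canonNode-standard n M (≤-trans (m≤n⊔m M k) le)
                (λ x lt → complete-valid n x (≤-trans lt (≤-trans (m≤m⊔n M k) le))))) (all y lt)) })
          (ev-× (complete-unbounded (M ⊔ k)) (ev-all M settled))
        good : ∀ n → event n ≡ false × (M ⊔ k) ≤ complete n × M ≤ n × confirmed (D n) n i M ≡ true → Good (nodeFor (D n) n i)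
        good n (e , le , M≤n , conf) = subst Good (sym (canonNode-standard n (c n) k≤ agree)) (standard (c n) (proj₁ best))
          where
          k≤ : k ≤ complete n
          k≤ = ≤-trans (m≤n⊔m M k) le
          best : M ≤ c n × confirmed (D n) n i (c n) ≡ true
          best = greatB-greatest (confirmed (D n) n i) (s≤s M≤n) conf
          no-escape : escapes n ≡ false
          no-escape = quiet n e k≤ (proj₂ best)
          agree : Agree (c n) (d n) lb
          agree x lt with bool-cases (lb x) | bool-cases (d n x)
          ... | inj₁ lx | inj₁ dx = trans dx (sym lx)
          ... | inj₂ lx | inj₂ dx = trans dx (sym lx)
          ... | inj₂ lx | inj₁ dx with trans (sym lx) (D-sound n x dx)
          ...   | ()
          agree x lt | inj₁ lx | inj₂ dx with trans (sym no-escape)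
            (anyB-true (λ l → lb l ∧ not (d n l)) lt (cong₂ _∧_ lx (cong not dx)))
          ... | ()

  -- Bounding the least undisputed candidate.

  Resolved : ℕ → ℕ → Set
  Resolved n k = disputed (D n) n k ≡ true ⊎ Good (nodeFor (D n) n (π₁ k))

  -- Below `horizon n` both kinds of limit have been reached: the content agrees with the language
  -- and every candidate is right or disputed.
  open Slow {λ n y → Agree y (d n) lb × (∀ k → k < y → Resolved n k)}
            (λ n → (λ x ()) , (λ k ()))
            (λ y → ev-× (eventually-agree y) (ev-all y Settle.settles))
    using () renaming (slow to horizon; slow-valid to horizon-valid; slow-step to horizon-step;
              slow≤ to horizon≤; slow-unbounded to horizon-unbounded)

  opaque
    about : List Sym → ℕ → Bool
    about u k = π₁ k ≡ᵇ index u

    active : ℕ → List Sym → Bool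
    active n u = anyB (about u) (horizon n)

    -- The largest candidate for `u` below the horizon. Thanks to the padding it tends to infinity
    -- with the horizon as long as `u` stays the same.
    K : ℕ → List Sym → ℕ
    K n u = greatB (about u) (horizon n)

    flagged : ℕ → List Sym → Bool
    flagged n u = active n u ∧ disputed (D n) n (K n u)

    attack : ℕ → List Sym → ℕ → Bool
    attack n u τ = anyB (λ l → testBit (D n) l ∧ denies n (extension (D n) (K n u) τ) l) (suc n)

    -- The disputing extension found with the least τ. When `u` is flagged, h denies a listed
    -- element there, so this sequence is not good; it is used only in that case.
    X : ℕ → List Sym → List Sym
    X n u = F (d n) (seq (π₁ (K n u))) ++ (can (d n) (K n u) ++ F (d n) (seq (pred (firstB (attack n u) (suc n)))))

    active-K : ∀ {n u} → active n u ≡ true → K n u < horizon n × π₁ (K n u) ≡ index u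
    active-K {n} {u} e with anyB-witness (about u) (horizon n) e
    ... | k , k< , ab = greatB-< (about u) (≤-trans (s≤s z≤n) k<) ,
          ≡ᵇ⇒≡ _ _ (subst T (sym (proj₂ (greatB-greatest (about u) k< ab))) _)

    active-intro : ∀ {n u k} → k < horizon n → π₁ k ≡ index u → active n u ≡ true × k ≤ K n u
    active-intro {n} {u} {k} k< eq = anyB-true (about u) k< ab , proj₁ (greatB-greatest (about u) k< ab)
      where
      ab : about u k ≡ true
      ab = T-true (≡⇒≡ᵇ (π₁ k) (index u) eq)

    flagged-active : ∀ {n u} → flagged n u ≡ true → active n u ≡ true
    flagged-active {n} {u} e = proj₁ (∧-true {active n u} e)

    unflagged : ∀ {n u} → flagged n u ≡ false → active n u ≡ true → disputed (D n) n (K n u) ≡ false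
    unflagged {n} {u} e a = trans (cong (_∧ disputed (D n) n (K n u)) (sym a)) e

    X-In : ∀ n u → All (In lb) (X n u)
    X-In n u = All.map (D-In {n}) (++⁺ (F-In (d n) (seq (π₁ (K n u))))
      (++⁺ (can-In (d n) (K n u)) (F-In (d n) (seq (pred (firstB (attack n u) (suc n)))))))

    X-extends : ∀ {n u} → active n u ≡ true → All (In lb) u → (u ++ can lb (K n u)) ⊑ X n u
    X-extends {n} {u} a all = subst (λ v → (u ++ can lb (K n u)) ⊑ (v ++ (can (d n) (K n u) ++ F (d n) (seq (pred (firstB (attack n u) (suc n))))))) (sym start)
      (⊑-++ u (subst (_⊑ (can (d n) (K n u) ++ F (d n) (seq (pred (firstB (attack n u) (suc n)))))) (can-agree (K n u) agree) (_ , refl)))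
      where
      agree : Agree (K n u) (d n) lb
      agree x lt = proj₁ (horizon-valid n) x (≤-trans lt (≤-trans (n≤1+n _) (proj₁ (active-K {n} {u} a))))
      start : F (d n) (seq (π₁ (K n u))) ≡ u
      start = trans (F-agree agree (All.map (λ b x eq → ≤-trans (b x eq) (π₁≤ (K n u))) (seq-below _)))
        (trans (cong (F lb ∘ seq) (proj₂ (active-K {n} {u} a))) (trans (cong (F lb) (seq-index u)) (F-id all)))

    X-bad : ∀ {n u} → flagged n u ≡ true → Good (codeSeq (X n u)) → ⊥
    X-bad {n} {u} e g = hit (anyB-witness (attack n u) (suc n) (proj₂ (∧-true {active n u} e)))
      where
      k : ℕ
      k = K n u
      refutes : ∀ m → (∃ λ l → l < suc n × testBit (D n) l ∧ denies n (extension (D n) k m) l ≡ true) →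
                Good (extension (D n) k m) → ⊥
      refutes m (l , _ , both) = refuted l n n (proj₁ (∧-true {testBit (D n) l} both)) (proj₂ (∧-true {testBit (D n) l} both))
      found : ∀ {τ} → (∃ λ m → firstB (attack n u) (suc n) ≡ suc m × m ≤ τ × attack n u m ≡ true) → ⊥
      found (m , eq , _ , at) = refutes m (anyB-witness (λ l → testBit (D n) l ∧ denies n (extension (D n) k m) l) (suc n) at)
        (subst Good (trans (cong (λ j → codeSeq (F (d n) (seq (π₁ k)) ++ (can (d n) k ++ F (d n) (seq j)))) (cong pred eq))
                           (sym (extension-correct (D n) k m))) g)
      hit : (∃ λ τ → τ < suc n × attack n u τ ≡ true) → ⊥
      hit (τ , τ< , at) = found (firstB-least (attack n u) τ< at)

  -- Appending the canonical listing makes the limit a text for the whole language even if every stage moves.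
  st : ℕ → List Sym
  st zero    = []
  st (suc n) = if flagged n (st n) then X n (st n) ++ can lb (suc n) else st n

  -- The listing behind `u` stops at `K n u`, the cut used in `X n u`. So the text can follow the
  -- canonical listing and still move into `X n u` later.
  tip : Bool → ℕ → List Sym → List Sym
  tip a n u = if a then u ++ can lb (K n u) else u

  W : ℕ → List Sym
  W n = tip (active n (st n)) n (st n)

  tip-extends : ∀ a n u → u ⊑ tip a n u
  tip-extends true  n u = _ , refl
  tip-extends false n u = ⊑-refl

  st-In : ∀ n → All (In lb) (st n)
  st-In zero = []
  st-In (suc n) with flagged n (st n)
  ... | true  = ++⁺ (X-In n (st n)) (can-In lb (suc n))
  ... | false = st-In n

  W-X : ∀ n → flagged n (st n) ≡ true → W n ⊑ X n (st n)
  W-X n e = subst (λ a → tip a n (st n) ⊑ X n (st n)) (sym (flagged-active {n} {st n} e)) (X-extends {n} {st n} (flagged-active {n} {st n} e) (st-In n))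

  st-flagged : ∀ n → flagged n (st n) ≡ true → st (suc n) ≡ X n (st n) ++ can lb (suc n)
  st-flagged n e = cong (if_then X n (st n) ++ can lb (suc n) else st n) e

  st-unflagged : ∀ n → flagged n (st n) ≡ false → st (suc n) ≡ st n
  st-unflagged n e = cong (if_then X n (st n) ++ can lb (suc n) else st n) e

  X-W : ∀ n → flagged n (st n) ≡ true → X n (st n) ⊑ W (suc n)
  X-W n e = ⊑-trans (subst (X n (st n) ⊑_) (sym (st-flagged n e)) (_ , refl)) (tip-extends (active (suc n) (st (suc n))) (suc n) (st (suc n)))

  W-chain : Chain W
  W-chain = record { grows = grows ; sound = sound ; covers = covers }
    where
    tip-mono : ∀ n u → tip (active n u) n u ⊑ tip (active (suc n) u) (suc n) u
    tip-mono n u with bool-cases (active n u)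
    ... | inj₂ e rewrite e = tip-extends (active (suc n) u) (suc n) u
    ... | inj₁ e with active-intro {suc n} {u} (≤-trans (proj₁ (active-K {n} {u} e)) (horizon-step n)) (proj₂ (active-K {n} {u} e))
    ...   | e' , le rewrite e | e' = ⊑-++ u (can-⊑ lb le)
    grows : ∀ n → W n ⊑ W (suc n)
    grows n with bool-cases (flagged n (st n))
    ... | inj₁ e = ⊑-trans (W-X n e) (X-W n e)
    ... | inj₂ e = subst (λ u → W n ⊑ tip (active (suc n) u) (suc n) u) (sym (st-unflagged n e)) (tip-mono n (st n))
    sound : ∀ n → All (In lb) (W n)
    sound n with active n (st n)
    ... | true  = ++⁺ (st-In n) (can-In lb (K n (st n)))
    ... | false = st-In n
    covers : ∀ y → ∃₂ λ n u → (u ++ can lb y) ⊑ W n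
    covers y = go (stay (N ∸ y))
      where
      k N : ℕ
      -- A candidate for the current prefix, padded with y so that the listing behind it reaches at
      -- least y.
      k = pr (index (st y)) y
      N = y ⊔ proj₁ (horizon-unbounded (suc k))
      -- Either some move happens at a moment n ≥ y, and `st (suc n)` ends with a listing beyond y,
      -- or the prefix is unchanged until `N`, when its listing has reached y.
      stay : ∀ j → (st (j + y) ≡ st y) ⊎ (∃ λ n → y ≤ n × flagged n (st n) ≡ true)
      stay zero = inj₁ refl
      stay (suc j) with stay j
      ... | inj₂ f = inj₂ f
      ... | inj₁ eq with bool-cases (flagged (j + y) (st (j + y)))
      ...   | inj₁ e = inj₂ (j + y , m≤n+m y j , e)
      ...   | inj₂ e = inj₁ (trans (st-unflagged (j + y) e) eq)
      go : (st (N ∸ y + y) ≡ st y) ⊎ (∃ λ n → y ≤ n × flagged n (st n) ≡ true) → ∃₂ λ n u → (u ++ can lb y) ⊑ W n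
      go (inj₂ (n , y≤n , e)) = suc n , X n (st n) , ⊑-trans (⊑-++ (X n (st n)) (can-⊑ lb (m≤n⇒m≤1+n y≤n)))
        (subst (_⊑ W (suc n)) (st-flagged n e) (tip-extends (active (suc n) (st (suc n))) (suc n) (st (suc n))))
      go (inj₁ eq) = N , st y , subst (λ u → (st y ++ can lb y) ⊑ tip (active N u) N u) (sym eq')
          (subst (λ a → (st y ++ can lb y) ⊑ tip a N (st y)) (sym (proj₁ act))
            (⊑-++ (st y) (can-⊑ lb (≤-trans (y≤pr (index (st y)) y) (proj₂ act)))))
        where
        eq' : st N ≡ st y
        eq' = trans (cong st (sym (m∸n+n≡m (m≤m⊔n y _)))) eq
        act : active N (st y) ≡ true × k ≤ K N (st y)
        act = active-intro {N} {st y} (proj₂ (horizon-unbounded (suc k)) N (m≤n⊔m y _)) (π₁-pr (index (st y)) y)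

  -- Once `W` is as long as `M`, a move would lead into a long prefix of the text that is not good.
  -- So the prefix is constant from `n₀` on and its candidate `K n u`, which lies below the horizon,
  -- is undisputed. The least undisputed candidate is then below the horizon too, and being resolved
  -- it is right.
  converges : Eventually (λ n → Good (node (D n) n))
  converges = ev-map good (ev-× (n₀ , λ n le → calm n le) (horizon-unbounded (suc k)))
    where
    M n₀ : ℕ
    M = proj₁ (chain-learn W-chain)
    n₀ = proj₁ (chain-long W-chain M)
    calm-flag : ∀ n → n₀ ≤ n → flagged n (st n) ≡ false
    calm-flag n le with bool-cases (flagged n (st n))
    ... | inj₂ e = e
    ... | inj₁ e = ⊥-elim (X-bad {n} {st n} e (proj₂ (chain-learn W-chain) {n = suc n} (X-W n e)
          (≤-trans (proj₂ (chain-long W-chain M)) (⊑-length (⊑-trans (chain-mono W-chain le) (W-X n e))))))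
    constant : ∀ {n} → n₀ ≤′ n → st n ≡ st n₀
    constant ≤′-refl          = refl
    constant (≤′-step {n} le) = trans (st-unflagged n (calm-flag n (≤′⇒≤ le))) (constant le)
    u : List Sym
    u = st n₀
    k : ℕ
    k = pr (index u) 0
    calm : ∀ n → n₀ ≤ n → flagged n u ≡ false
    calm n le = subst (λ v → flagged n v ≡ false) (constant (≤⇒≤′ le)) (calm-flag n le)
    good : ∀ n → flagged n u ≡ false × suc k ≤ horizon n → Good (node (D n) n)
    -- `horizon n` ≤ n puts `K n u` within the range of the search, so the default of `candidate`
    -- does not occur.
    good n (e , k<) = settle (firstB-least fresh (m≤n⇒m≤1+n (≤-trans K< (horizon≤ n))) (cong not (unflagged {n} {u} e a)))
      where
      fresh : ℕ → Bool
      fresh k = not (disputed (D n) n k)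
      a : active n u ≡ true
      a = proj₁ (active-intro {n} {u} k< (π₁-pr (index u) 0))
      K< : K n u < horizon n
      K< = proj₁ (active-K {n} {u} a)
      chosen : ∀ m → fresh m ≡ true → Resolved n m → Good (nodeFor (D n) n (π₁ m))
      chosen m f (inj₂ g) = g
      chosen m f (inj₁ dis) with trans (sym (cong not dis)) f
      ... | ()
      settle : (∃ λ m → firstB fresh (suc n) ≡ suc m × m ≤ K n u × fresh m ≡ true) → Good (node (D n) n)
      settle (m , eq , m≤K , f) = subst (λ j → Good (nodeFor (D n) n (π₁ (pred j)))) (sym eq)
        (chosen m f (proj₂ (horizon-valid n) m (≤-<-trans m≤K K<)))

open Equivalence using (to; from)

-- Canonical indices

double-half : ∀ c k → ⌊ c + (k + k) /2⌋ ≡ ⌊ c /2⌋ + k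
double-half c zero    = trans (cong ⌊_/2⌋ (+-identityʳ c)) (sym (+-identityʳ _))
double-half c (suc k) = trans (cong ⌊_/2⌋ (trans (cong (c +_) (cong suc (+-suc k k)))
    (trans (+-suc c _) (cong suc (+-suc c (k + k))))))
  (trans (cong suc (double-half c k)) (sym (+-suc _ k)))

double-mod : ∀ c k → (c + (k + k)) % 2 ≡ c % 2
double-mod c k = trans (cong (λ m → (c + m) % 2) (trans (cong (k +_) (sym (+-identityʳ k))) (*-comm 2 k))) ([m+kn]%n≡m%n c k 2)

2^suc : ∀ y → 2 ^ suc y ≡ 2 ^ y + 2 ^ y
2^suc y = cong (2 ^ y +_) (+-identityʳ (2 ^ y))

-- Halving moves bit y to bit y - 1 and 2 ^ suc y to 2 ^ y, which reduces the claim to adding 1 to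
-- an even number.
testBit-add : ∀ y c → testBit c y ≡ false → testBit (c + 2 ^ y) y ≡ true
testBit-add zero c e = odd c (even c e)
  where
  even : ∀ c → (c % 2 ≡ᵇ 1) ≡ false → c % 2 ≡ 0
  even c e with c % 2 | m%n<n c 2
  ... | zero        | _ = refl
  even c () | suc zero | _
  ... | suc (suc _) | s≤s (s≤s ())
  odd : ∀ c → c % 2 ≡ 0 → ((c + 1) % 2 ≡ᵇ 1) ≡ true
  odd c e = cong (_≡ᵇ 1) (trans (%-distribˡ-+ c 1 2) (cong (λ r → (r + 1) % 2) e))
testBit-add (suc y) c e = trans (cong (λ m → testBit m y) (trans (cong (λ p → ⌊ c + p /2⌋) (2^suc y)) (double-half c (2 ^ y))))
  (testBit-add y ⌊ c /2⌋ e)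

-- Adding a power of two at a clear bit produces no carry; halving again reduces this to bit 0.
testBit-other : ∀ y c x → x ≢ y → testBit c y ≡ false → testBit (c + 2 ^ y) x ≡ testBit c x
testBit-other zero    c zero    ne e = ⊥-elim (ne refl)
testBit-other zero    c (suc x) ne e = cong (λ m → testBit m x) (half-even c e)
  where
  half-even : ∀ c → (c % 2 ≡ᵇ 1) ≡ false → ⌊ c + 1 /2⌋ ≡ ⌊ c /2⌋
  half-even zero          e = refl
  half-even (suc (suc c)) e = cong suc (half-even c e)
testBit-other (suc y) c zero    ne e = cong (_≡ᵇ 1) (trans (cong (λ p → (c + p) % 2) (2^suc y)) (double-mod c (2 ^ y)))
testBit-other (suc y) c (suc x) ne e = trans
  (cong (λ m → testBit m x) (trans (cong (λ p → ⌊ c + p /2⌋) (2^suc y)) (double-half c (2 ^ y))))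
  (testBit-other y ⌊ c /2⌋ x (ne ∘ cong suc) e)

insertBit-here : ∀ y c → testBit (insertBit y c) y ≡ true
insertBit-here y c with testBit c y in e
... | true  = e
... | false = testBit-add y c e

insertBit-keep : ∀ y c x → testBit c x ≡ true → testBit (insertBit y c) x ≡ true
insertBit-keep y c x t with testBit c y in e
... | true  = t
... | false with x ≟ y
...   | yes refl = testBit-add y c e
...   | no ne    = trans (testBit-other y c x ne e) t

insertBit-inv : ∀ y c x → testBit (insertBit y c) x ≡ true → x ≡ y ⊎ testBit c x ≡ true
insertBit-inv y c x t with testBit c y in e
... | true  = inj₂ t
... | false with x ≟ y
...   | yes eq = inj₁ eq
...   | no ne  = inj₂ (trans (sym (testBit-other y c x ne e)) t)

testBit-zero : ∀ x → testBit 0 x ≡ false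
testBit-zero zero    = refl
testBit-zero (suc x) = testBit-zero x

codeContent-∈ : ∀ w x → just x ∈ w → testBit (codeContent w) x ≡ true
codeContent-∈ (just y ∷ w)  .y (here refl) = insertBit-here y (codeContent w)
codeContent-∈ (just y ∷ w)  x  (there x∈)  = insertBit-keep y (codeContent w) x (codeContent-∈ w x x∈)
codeContent-∈ (nothing ∷ w) x  (there x∈)  = codeContent-∈ w x x∈

∈-codeContent : ∀ w x → testBit (codeContent w) x ≡ true → just x ∈ w
∈-codeContent [] x t with trans (sym (testBit-zero x)) t
... | ()
∈-codeContent (nothing ∷ w) x t = there (∈-codeContent w x t)
∈-codeContent (just y ∷ w)  x t with insertBit-inv y (codeContent w) x t
... | inj₁ refl = here refl
... | inj₂ t'   = there (∈-codeContent w x t')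

-- Programs as learners

run₁ : Exp 1 → Code
run₁ e = comp′ (compile e) (pair′ id′ zero′)

eval-run₁ : ∀ e x → Eval (run₁ e) x (⟦ e ⟧ (x ∷ []))
eval-run₁ e x = ev-comp (eval-pr (eval-id x) ev-zero) (compile-correct e (x ∷ []))

run₂ : Exp 2 → Code
run₂ e = comp′ (compile e) (pair′ left′ (pair′ right′ zero′))

eval-run₂ : ∀ e x y → Eval (run₂ e) (pair x y) (⟦ e ⟧ (x ∷ y ∷ []))
eval-run₂ e x y = subst (λ p → Eval (run₂ e) p (⟦ e ⟧ (x ∷ y ∷ []))) (pr≡pair x y)
  (ev-comp (eval-pr (eval-left x y) (eval-pr (eval-right x y) ev-zero)) (compile-correct e (x ∷ y ∷ [])))

addE : Exp 2
addE = `rec (v 0) (v 1) (`suc (v 1))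

add-correct : ∀ a b → ⟦ addE ⟧ (a ∷ b ∷ []) ≡ a + b
add-correct zero    b = refl
add-correct (suc a) b = cong suc (add-correct a b)

pow2E : Exp 1
pow2E = `rec (v 0) (lit 1) (call addE (v 1 ∷ v 1 ∷ []))

pow2-correct : ∀ y → ⟦ pow2E ⟧ (y ∷ []) ≡ 2 ^ y
pow2-correct = go
  where
  go : ∀ y → natrec 1 (λ _ i → ⟦ addE ⟧ (i ∷ i ∷ [])) y ≡ 2 ^ y
  go zero    = refl
  go (suc y) = trans (add-correct p p) (trans (cong₂ _+_ (go y) (go y)) (sym (2^suc y)))
    where
    p : ℕ
    p = natrec 1 (λ _ i → ⟦ addE ⟧ (i ∷ i ∷ [])) y

reverseE insertE countE : Exp 3
reverseE = `suc (`pair (v 0) (v 1))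
insertE  = ifz (v 0) (v 1)
  (`if (call testBitE (v 1 ∷ `pred (v 0) ∷ [])) (v 1) (call addE (v 1 ∷ call pow2E (`pred (v 0) ∷ []) ∷ [])))
countE   = `suc (v 1)

insert-correct : ∀ s c D → ⟦ insertE ⟧ (codeSym s ∷ c ∷ D ∷ []) ≡ insertSym s c
insert-correct nothing  c D = refl
insert-correct (just x) c D = trans
  (`if-correct {ρ = just′ ∷ c ∷ D ∷ []} (call testBitE (v 1 ∷ `pred (v 0) ∷ [])) (v 1) (call addE (v 1 ∷ call pow2E (`pred (v 0) ∷ []) ∷ []))
    (testBit-correct c x))
  (cong (if testBit c x then c else_) (trans (add-correct c _) (cong (c +_) (pow2-correct x))))
  where
  just′ : ℕ
  just′ = suc x

foldl-cong : ∀ {A : Set} {f g : A → Sym → A} → (∀ a s → f a s ≡ g a s) → ∀ a w → foldl f a w ≡ foldl g a w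
foldl-cong eq a []      = refl
foldl-cong {g = g} eq a (s ∷ w) = trans (foldl-cong eq _ w) (cong (λ b → foldl g b w) (eq a s))

fold-codeSeq : ∀ g w a → ⟦ foldE g ⟧ (codeSeq w ∷ a ∷ 0 ∷ []) ≡
  foldl (λ a s → ⟦ g ⟧ (codeSym s ∷ a ∷ 0 ∷ [])) a w
fold-codeSeq g w a = trans (fold-correct g (codeSeq w) a 0) (drained (λ s a → ⟦ g ⟧ (s ∷ a ∷ 0 ∷ [])) w a)

reverse-correct : ∀ w → ⟦ foldE reverseE ⟧ (codeSeq w ∷ 0 ∷ 0 ∷ []) ≡ codeSeq (reverse w)
reverse-correct w = trans (fold-codeSeq reverseE w 0) (go w [])
  where
  go : ∀ w u → foldl (λ a s → suc (pr (codeSym s) a)) (codeSeq u) w ≡ codeSeq (foldl (λ u s → s ∷ u) u w)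
  go []      u = refl
  go (s ∷ w) u = trans (cong (λ a → foldl _ (suc a) w) (pr≡pair (codeSym s) (codeSeq u))) (go w (s ∷ u))

count-correct : ∀ w → ⟦ foldE countE ⟧ (codeSeq w ∷ 0 ∷ 0 ∷ []) ≡ length w
count-correct w = trans (fold-codeSeq countE w 0) (trans (go w 0) (+-identityʳ _))
  where
  go : ∀ w a → foldl (λ a _ → suc a) a w ≡ length w + a
  go []      a = refl
  go (_ ∷ w) a = trans (go w (suc a)) (+-suc _ a)

-- `foldE` folds from the left and `codeContent` from the right. Reversing first turns one into the
-- other, with no appeal to insertions commuting.
content-correct : ∀ w → ⟦ foldE insertE ⟧ (codeSeq (reverse w) ∷ 0 ∷ 0 ∷ []) ≡ codeContent w
content-correct w = trans (fold-codeSeq insertE (reverse w) 0)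
  (trans (foldl-cong (λ a s → insert-correct s a 0) 0 (reverse w)) (reverse-foldl (λ a s → insertSym s a) 0 w))

forgetE : Exp 1
forgetE = `pair (call (foldE insertE) (call (foldE reverseE) (v 0 ∷ lit 0 ∷ lit 0 ∷ []) ∷ lit 0 ∷ lit 0 ∷ []))
                (call (foldE countE) (v 0 ∷ lit 0 ∷ lit 0 ∷ []))

forget-correct : ∀ w → ⟦ forgetE ⟧ (codeSeq w ∷ []) ≡ pair (codeContent w) (length w)
forget-correct w = trans (cong₂ pr
    (trans (cong (λ r → ⟦ foldE insertE ⟧ (r ∷ 0 ∷ 0 ∷ [])) (reverse-correct w)) (content-correct w))
    (count-correct w))
  (pr≡pair _ _)

Psd⇒G : ∀ h → ∃ λ g → ∀ L → Learns Psd h L → Learns G g L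
Psd⇒G h = proj₁ g , λ L learns T text → converge T (learns T text)
  where
  g : ∃ λ e → ∀ {x k} → Eval (comp′ (decode h) (run₁ forgetE)) x k → φ e x k
  g = gödel (comp′ (decode h) (run₁ forgetE))
  input : ∀ T n → ⟦ forgetE ⟧ (codeSeq (initSeg T n) ∷ []) ≡ pair (codeContent (initSeg T n)) n
  input T n = trans (forget-correct (initSeg T n))
    (cong (pair (codeContent (initSeg T n))) (trans (length-map T (upTo n)) (length-upTo n)))
  converge : ∀ T → BcC (Psd h T) T → BcC (G (proj₁ g) T) T
  converge T (n₀ , c) = n₀ , λ n le → let (e , ev , correct) = c n le in
    e , proj₂ g (ev-comp (subst (Eval (run₁ forgetE) (codeSeq (initSeg T n))) (input T n) (eval-run₁ forgetE _)) ev) , correct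

-- Correctness for recursive languages.

≐-trans : ∀ {A B C : SetN} → A ≐ B → B ≐ C → A ≐ C
≐-trans p q x = mk⇔ (λ a → to (q x) (to (p x) a)) (λ c → from (p x) (from (q x) c))

≐-sym : ∀ {A B : SetN} → A ≐ B → B ≐ A
≐-sym p x = mk⇔ (from (p x)) (to (p x))

module _ (h : ℕ) (L : SetN) (rec : Recursive L) (learns : Learns G h L) where

  private
    e₀ : ℕ
    e₀ = proj₁ rec

  decide : ℕ → Bool
  decide x with proj₁ (proj₂ rec) x
  ... | k , _ , inj₁ _ = false
  ... | k , _ , inj₂ _ = true

  decide-sound : ∀ x → decide x ≡ true → L x
  decide-sound x eq with proj₁ (proj₂ rec) x
  ... | .1 , D , inj₂ refl = to (proj₂ (proj₂ rec) x) D

  decide-complete : ∀ x → L x → decide x ≡ true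
  decide-complete x Lx with proj₁ (proj₂ rec) x
  ... | k , _ , inj₂ _ = refl
  ... | .0 , D , inj₁ refl with φ-functional {e₀} {x} D (from (proj₂ (proj₂ rec) x) Lx)
  ...   | ()

  Good : ℕ → Set
  Good ρ = ∃ λ e → φ h ρ e × IsCIndex e × (C e ≐ L)

  good-in : ∀ {ρ l} s → Good ρ → decide l ≡ true → Learner.denies h s ρ l ≡ true → ⊥
  good-in {l = l} s (e , D , _ , iff) l∈ = Learner.denies-sound h s {e = e} D (from (iff l) (decide-sound l l∈))

  good-out : ∀ {ρ l} → Good ρ → decide l ≡ false → ∃ λ s → Learner.denies h s ρ l ≡ true
  good-out {l = l} (e , D , total , iff) l∉ with total l
  ... | .0 , D' , inj₁ refl = Learner.denies-complete h {e = e} D D'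
  ... | .1 , D' , inj₂ refl with trans (sym (decide-complete l (to (iff l) D'))) l∉
  ...   | ()

  learn : ∀ (U : Text) → (∀ x → decide x ≡ true → ∃ λ n → U n ≡ just x) → (∀ n → In decide (U n)) →
          Eventually (λ n → Good (codeSeq (initSeg U n)))
  learn U exhausts sound = ev-map (λ { n (e , D , total , iff) → e , D , total , ≐-trans iff text }) (learns U text)
    where
    text : TextFor U L
    text x = mk⇔ (λ { (n , eq) → decide-sound x (In.listed (sound n) x eq) }) (λ Lx → exhausts x (decide-complete x Lx))

  learns-Psd : ∀ g → (∀ D n {e} → φ h (Learner.node h D n) e → φ g (pair D n) e) → Learns Psd g L
  learns-Psd g run T text = ev-map (λ { n (e , D , total , iff) → e , run (index′ n) n D , total , ≐-trans iff (≐-sym text) }) converges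
    where
    index′ : ℕ → ℕ
    index′ n = codeContent (initSeg T n)
    listed-at : ∀ {n x} → testBit (index′ n) x ≡ true → ∃ λ m → m < n × T m ≡ just x
    listed-at {n} {x} t with ∈-map⁻ T (∈-codeContent (initSeg T n) x t)
    ... | m , m∈ , eq = m , ∈-upTo⁻ m∈ , sym eq
    at-listed : ∀ {n x m} → m < n → T m ≡ just x → testBit (index′ n) x ≡ true
    at-listed {n} {x} lt eq = codeContent-∈ (initSeg T n) x (subst (_∈ initSeg T n) eq (∈-map⁺ T (∈-upTo⁺ lt)))
    index-mono : ∀ {m n} x → m ≤ n → testBit (index′ m) x ≡ true → testBit (index′ n) x ≡ true
    index-mono {m} {n} x m≤n t with listed-at {m} {x} t
    ... | j , lt , eq = at-listed {n} (≤-trans lt m≤n) eq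
    index-sound : ∀ n x → testBit (index′ n) x ≡ true → decide x ≡ true
    index-sound n x t with listed-at {n} {x} t
    ... | j , lt , eq = decide-complete x (to (text x) (j , eq))
    index-complete : ∀ x → decide x ≡ true → ∃ λ n → testBit (index′ n) x ≡ true
    index-complete x t with from (text x) (decide-sound x t)
    ... | j , eq = suc j , at-listed {suc j} ≤-refl eq
    open Convergence h decide Good good-in good-out learn index′ index-mono index-sound index-complete

-- The index is built from `h` alone and so serves all languages at once. Recursiveness of `L`
-- enters only the convergence argument, where it supplies the decision procedure.
G⇒Psd : ∀ h → ∃ λ g → ∀ L → Recursive L → Learns G h L → Learns Psd g L
G⇒Psd h = proj₁ g , λ L rec learns → learns-Psd h L rec learns (proj₁ g)
  λ D n ev → proj₂ g (ev-comp (subst (Eval (run₂ nodeE) (pair D n)) (node-program D n) (eval-run₂ nodeE D n)) ev)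
  where
  open Learner h
  g : ∃ λ e → ∀ {x k} → Eval (comp′ (decode h) (run₂ nodeE)) x k → φ e x k
  g = gödel (comp′ (decode h) (run₂ nodeE))

theorem17 : (𝓛 : SetN → Set) → InClassREC Psd 𝓛 ⇔ InClassREC G 𝓛
theorem17 𝓛 = mk⇔
  (λ { (rec , h , learns) → rec , proj₁ (Psd⇒G h) , λ L L∈ → proj₂ (Psd⇒G h) L (learns L L∈) })
  (λ { (rec , h , learns) → rec , proj₁ (G⇒Psd h) , λ L L∈ → proj₂ (G⇒Psd h) L (rec L L∈) (learns L L∈) })
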